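{- Let $q$ be a power of $2$, let $n$ be a positive integer, let $L_0$ and $L_1$ be $q$-linear polynomials over $\mathbb F_{q^n}$, and let $l$ be a nonnegative integer. Then $L_0\big(x^{2^l}\big)+L_1(x)\mathrm{Tr}(x)$ is a permutation polynomial of $\mathbb F_{q^n}$ if and only if, for every $u\in\mathbb F_{q^n}^*$, at least one of the following holds: \begin{itemize} \item $L_1^\prime(u)\in\mathbb F_q$ and $L_0^\prime(u)^2+L_1^\prime(u)^{2^l}\ne0$; \item $1,L_0^\prime(u),L_1^\prime(u)^{2^l}$ are linearly independent over $\mathbb F_q$. \end{itemize}
   Context: $\mathrm{Tr}$ is the trace map of $\mathbb F_{q^n}/\mathbb F_q$, so $\mathrm{Tr}(x)=\sum_{i=0}^{n-1}x^{q^i}$. A $q$-linear polynomial over $\mathbb F_{q^n}$ is a polynomial of the form $L(x)=\sum_ia_ix^{q^i}$ with $a_i\in\mathbb F_{q^n}$; polynomials are identified with the maps they induce on $\mathbb F_{q^n}$ (so $x^{q^n}=x$). For such $L$, define $L^\prime(x)=\sum_i(a_ix)^{q^{ -i}}$, where $x\mapsto x^{q^{ -1}}$ denotes the inverse of the automorphism $x\mapsto x^q$ of $\mathbb F_{q^n}$ (and $x\mapsto x^{q^{ -i}}$ is its $i$-th iterate). A permutation polynomial of $\mathbb F_{q^n}$ is a polynomial over $\mathbb F_{q^n}$ whose induced map on $\mathbb F_{q^n}$ is a bijection. -}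

module Defs where

open import Algebra.Apartness.Bundles using (HeytingField; HeytingCommutativeRing)
open import Algebra.Bundles using (CommutativeRing)
open import Algebra.Morphism.Structures using (module RingMorphisms)
open import Data.Fin.Base using (Fin; toℕ; punchIn)
open import Data.Fin.Permutation as Perm using (Permutation′)
import Data.Fin.Properties as Fin
open import Data.Nat.Base as ℕ using (ℕ; zero; suc; NonZero)
open import Data.Nat.GeneralisedArithmetic using (iterate)
import Data.Nat.Properties as ℕ
open import Data.Product.Base using (_,_; ∃; proj₁; proj₂)
open import Data.Vec.Functional using (Vector; removeAt; replicate)
open import Function.Base using (_∘_)
open import Function.Bundles using (Inverse)
open import Function.Definitions using (Bijective)
open import Level using (Level; _⊔_)
import Level
open import Relation.Binary.Bundles using (Setoid)
import Relation.Binary.PropositionalEquality as ≡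
open ≡ using (_≡_)
open import Relation.Nullary using (¬_; yes; no; contradiction)

private
  variable
    c ℓ₁ ℓ₂ d e₁ e₂ : Level

HasCardinality : Setoid c ℓ₁ → ℕ → Set (c ⊔ ℓ₁)
HasCardinality S N = Inverse (≡.setoid (Fin N)) S

-- Field notions for a `HeytingField`, whose bundle does not re-export them.
-- Over a finite carrier `_≈_` is decidable and x # y holds exactly when ¬ x ≈ y,
-- so a finite `HeytingField` is a finite field in the usual sense.
module FieldOps (F : HeytingField c ℓ₁ ℓ₂) where

  open HeytingField F using (heytingCommutativeRing)

  commutativeRing : CommutativeRing c ℓ₁
  commutativeRing = HeytingCommutativeRing.commutativeRing heytingCommutativeRing

  open CommutativeRing commutativeRing public

  open import Algebra.Properties.Semiring.Exp semiring public
  open import Algebra.Properties.CommutativeMonoid.Sum +-commutativeMonoid public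
    using (sum; sum-syntax)

module _ (F : HeytingField c ℓ₁ ℓ₂) where

  open HeytingField F using (_#_; tight; #⇒invertible; heytingCommutativeRing)
  open FieldOps F
  open import Algebra.Apartness.Properties.HeytingCommutativeRing heytingCommutativeRing
    using (x#0y#0→xy#0; 1#0; x-0≈x)
  open import Algebra.Properties.Ring ring using (-‿distribˡ-*; x∙y⁻¹≈ε⇒x≈y)
  open import Relation.Binary.Reasoning.Setoid setoid
  import Algebra.Properties.CommutativeMonoid.Sum *-commutativeMonoid as ∏

  private
    ≉0⇒¬¬#0 : ∀ {x} → ¬ x ≈ 0# → ¬ ¬ x # 0#
    ≉0⇒¬¬#0 x≉0 ¬x#0 = x≉0 (proj₁ (tight _ _) ¬x#0)

    #0⇒≉0 : ∀ {x} → x # 0# → ¬ x ≈ 0#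
    #0⇒≉0 x#0 x≈0 = proj₂ (tight _ _) x≈0 x#0

    *-≉0 : ∀ {x y} → ¬ x ≈ 0# → ¬ y ≈ 0# → ¬ x * y ≈ 0#
    *-≉0 x≉0 y≉0 xy≈0 = ≉0⇒¬¬#0 x≉0 λ x#0 → ≉0⇒¬¬#0 y≉0 λ y#0 →
      #0⇒≉0 (x#0y#0→xy#0 x#0 y#0) xy≈0

    *-cancelʳ-1 : ∀ {x y} → ¬ y ≈ 0# → x * y ≈ y → x ≈ 1#
    *-cancelʳ-1 {x} {y} y≉0 xy≈y = x∙y⁻¹≈ε⇒x≈y x 1# (proj₁ (tight _ _) λ x-1#0 →
      *-≉0 (#0⇒≉0 x-1#0) y≉0 (begin
        (x - 1#) * y        ≈⟨ distribʳ y x (- 1#) ⟩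
        x * y + - 1# * y    ≈⟨ +-cong xy≈y (sym (-‿distribˡ-* 1# y)) ⟩
        y + - (1# * y)      ≈⟨ +-congˡ (-‿cong (*-identityˡ y)) ⟩
        y - y               ≈⟨ -‿inverseʳ y ⟩
        0#                  ∎))

    ∏-≉0 : ∀ {n} (v : Vector Carrier n) → (∀ i → ¬ v i ≈ 0#) → ¬ ∏.sum v ≈ 0#
    ∏-≉0 {zero}  v v≉0 = #0⇒≉0 1#0
    ∏-≉0 {suc n} v v≉0 = *-≉0 (v≉0 Fin.zero) (∏-≉0 (v ∘ Fin.suc) (v≉0 ∘ Fin.suc))

  module _ {N : ℕ} (enum : HasCardinality setoid (suc N)) where
    open Inverse enum
      renaming (to to elem; from to index; from-cong to index-cong;
                strictlyInverseˡ to elem-index; strictlyInverseʳ to index-elem)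

    private
      i₀ : Fin (suc N)
      i₀ = index 0#

      module _ (a : Carrier) (a#0 : a # 0#) where
        a-inverse = #⇒invertible a#0
        a⁻¹ = proj₁ a-inverse

        a-0≈a : a - 0# ≈ a
        a-0≈a = x-0≈x a

        a⁻¹a≈1 : a⁻¹ * a ≈ 1#
        a⁻¹a≈1 = trans (*-congˡ (sym a-0≈a)) (proj₁ (proj₂ a-inverse))

        a⁻¹[ax]≈x : ∀ x → a⁻¹ * (a * x) ≈ x
        a⁻¹[ax]≈x x = trans (sym (*-assoc a⁻¹ a x)) (trans (*-congʳ a⁻¹a≈1) (*-identityˡ x))

        a[a⁻¹x]≈x : ∀ x → a * (a⁻¹ * x) ≈ x
        a[a⁻¹x]≈x x = trans (sym (*-assoc a a⁻¹ x))
          (trans (*-congʳ (trans (*-comm a a⁻¹) a⁻¹a≈1)) (*-identityˡ x))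

        scale : Carrier → Fin (suc N) → Fin (suc N)
        scale b i = index (b * elem i)

        scale-scale : ∀ b b′ → (∀ x → b * (b′ * x) ≈ x) → ∀ i → scale b (scale b′ i) ≡ i
        scale-scale b b′ inv i = ≡.trans
          (index-cong (trans (*-congˡ (elem-index (b′ * elem i))) (inv (elem i))))
          (index-elem i)

        π : Permutation′ (suc N)
        π = Perm.permutation (scale a) (scale a⁻¹)
          (scale-scale a a⁻¹ a[a⁻¹x]≈x) (scale-scale a⁻¹ a a⁻¹[ax]≈x)

        -- The nonzero elements, with 1 in the place of 0.
        g : Vector Carrier (suc N)
        g i with i Fin.≟ i₀
        ... | yes _ = 1#
        ... | no  _ = elem i

        h : Vector Carrier (suc N)
        h i with i Fin.≟ i₀
        ... | yes _ = 1#
        ... | no  _ = a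

        elem≉0 : ∀ {i} → ¬ i ≡ i₀ → ¬ elem i ≈ 0#
        elem≉0 {i} i≢i₀ eᵢ≈0 = i≢i₀ (≡.trans (≡.sym (index-elem i)) (index-cong eᵢ≈0))

        g≉0 : ∀ i → ¬ g i ≈ 0#
        g≉0 i with i Fin.≟ i₀
        ... | yes _    = #0⇒≉0 1#0
        ... | no i≢i₀ = elem≉0 i≢i₀

        g∘π : ∀ i → g (scale a i) ≈ h i * g i
        g∘π i with i Fin.≟ i₀ | scale a i Fin.≟ i₀
        ... | yes _      | yes _     = sym (*-identityˡ 1#)
        ... | no  _      | no  _     = elem-index (a * elem i)
        ... | yes ≡.refl | no  si≢i₀ = contradiction
          (index-cong (trans (*-congˡ (elem-index 0#)) (zeroʳ a))) si≢i₀
        ... | no  i≢i₀   | yes si≡i₀ = contradiction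
          (trans (sym (elem-index (a * elem i)))
            (trans (reflexive (≡.cong elem si≡i₀)) (elem-index 0#)))
          (*-≉0 (#0⇒≉0 a#0) (elem≉0 i≢i₀))

        h-i₀ : h i₀ ≈ 1#
        h-i₀ with i₀ Fin.≟ i₀
        ... | yes _     = refl
        ... | no  i₀≢i₀ = contradiction ≡.refl i₀≢i₀

        h-≢ : ∀ j → removeAt h i₀ j ≈ a
        h-≢ j with punchIn i₀ j Fin.≟ i₀
        ... | yes eq = contradiction eq (Fin.punchInᵢ≢i i₀ j)
        ... | no  _  = refl

        ∏h : ∏.sum h ≈ a ^ N
        ∏h = begin
          ∏.sum h                         ≈⟨ ∏.sum-remove {i = i₀} h ⟩
          h i₀ * ∏.sum (removeAt h i₀)    ≈⟨ *-cong h-i₀ (∏.sum-cong-≋ h-≢) ⟩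
          1# * ∏.sum (replicate N a)      ≈⟨ *-identityˡ _ ⟩
          ∏.sum (replicate N a)           ≈⟨ ∏.sum-replicate N ⟩
          a ^ N                           ∎

        a^N≈1 : a ^ N ≈ 1#
        a^N≈1 = *-cancelʳ-1 (∏-≉0 g g≉0) (begin
          a ^ N * ∏.sum g                 ≈⟨ *-congʳ ∏h ⟨
          ∏.sum h * ∏.sum g               ≈⟨ ∏.∑-distrib-+ h g ⟨
          ∏.sum (λ i → h i * g i)         ≈⟨ ∏.sum-cong-≋ g∘π ⟨
          ∏.sum (g ∘ scale a)             ≈⟨ ∏.sum-permute g π ⟨
          ∏.sum g                         ∎)

    x^|F|≈x′ : ∀ x → x ^ suc N ≈ x
    x^|F|≈x′ x with index x Fin.≟ i₀
    ... | yes eq = begin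
      x * x ^ N   ≈⟨ *-congʳ x≈0 ⟩
      0# * x ^ N  ≈⟨ zeroˡ _ ⟩
      0#          ≈⟨ x≈0 ⟨
      x           ∎
      where
      x≈0 : x ≈ 0#
      x≈0 = trans (sym (elem-index x)) (trans (reflexive (≡.cong elem eq)) (elem-index 0#))
    ... | no  ne = proj₁ (tight _ _) λ xᴺ#x →
      ≉0⇒¬¬#0 (ne ∘ index-cong) λ x#0 →
      proj₂ (tight _ _) (trans (*-congˡ (a^N≈1 x x#0)) (*-identityʳ x)) xᴺ#x

  -- The convention x^(qⁿ) = x, from which the inverse of x ↦ x^q is obtained.
  x^|F|≈x : ∀ {N} → HasCardinality setoid N → ∀ x → x ^ N ≈ x
  x^|F|≈x {zero}  enum x with () ← Inverse.from enum x
  x^|F|≈x {suc N} enum x = x^|F|≈x′ enum x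

-- 𝔽_q and 𝔽_{qⁿ} are fields with q and qⁿ elements; 𝔽_q is identified with its
-- image under ι.
record FiniteFieldExtension (q n : ℕ) (c ℓ₁ ℓ₂ d e₁ e₂ : Level)
       : Set (Level.suc (c ⊔ ℓ₁ ⊔ ℓ₂ ⊔ d ⊔ e₁ ⊔ e₂)) where
  field
    base : HeytingField c ℓ₁ ℓ₂
    top  : HeytingField d e₁ e₂

  module K = FieldOps base
  module F = FieldOps top

  field
    base-card : HasCardinality K.setoid q
    top-card  : HasCardinality F.setoid (q ℕ.^ n)
    ι         : K.Carrier → F.Carrier
    ι-isRingMonomorphism : RingMorphisms.IsRingMonomorphism
                             (CommutativeRing.rawRing K.commutativeRing)
                             (CommutativeRing.rawRing F.commutativeRing) ι

module QLinear {q n : ℕ} .{{_ : NonZero n}}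
               (E : FiniteFieldExtension q n c ℓ₁ ℓ₂ d e₁ e₂) where

  open FiniteFieldExtension E
  open F

  InBase : Carrier → Set _
  InBase x = ∃ λ (k : K.Carrier) → ι k ≈ x

  LinearlyIndependent : ∀ {r} → Vector Carrier r → Set _
  LinearlyIndependent {r} v =
    ∀ (k : Vector K.Carrier r) → ∑[ i < r ] (ι (k i) * v i) ≈ 0# → ∀ i → k i K.≈ K.0#

  Tr : Carrier → Carrier
  Tr x = ∑[ i < n ] (x ^ (q ℕ.^ toℕ i))

  frobenius : Inverse setoid setoid
  frobenius = record
    { to        = _^ q
    ; from      = _^ q′
    ; to-cong   = ^-congˡ q
    ; from-cong = ^-congˡ q′
    ; inverse   = (λ {x} y≈ → trans (^-congˡ q y≈) (roundtrip q′ q q′q≡qⁿ x))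
                , (λ {x} y≈ → trans (^-congˡ q′ y≈) (roundtrip q q′ qq′≡qⁿ x))
    }
    where
    q′ = q ℕ.^ ℕ.pred n

    qq′≡qⁿ : q ℕ.* q′ ≡ q ℕ.^ n
    qq′≡qⁿ = ≡.cong (q ℕ.^_) (ℕ.suc-pred n)

    q′q≡qⁿ : q′ ℕ.* q ≡ q ℕ.^ n
    q′q≡qⁿ = ≡.trans (ℕ.*-comm q′ q) qq′≡qⁿ

    roundtrip : ∀ r s → r ℕ.* s ≡ q ℕ.^ n → ∀ x → (x ^ r) ^ s ≈ x
    roundtrip r s rs≡qⁿ x =
      trans (^-assocʳ x r s) (trans (^-congʳ x rs≡qⁿ) (x^|F|≈x top top-card x))

  frobenius⁻¹ : Carrier → Carrier
  frobenius⁻¹ = Inverse.from frobenius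

  -- Σ_{i < terms} aᵢ x^(qⁱ), where i may exceed n − 1.
  record QLinearPolynomial : Set d where
    field
      terms : ℕ
      coeff : Vector Carrier terms

  infix 9 _⟨_⟩ _′⟨_⟩

  _⟨_⟩ : QLinearPolynomial → Carrier → Carrier
  L ⟨ x ⟩ = ∑[ i < terms ] (coeff i * x ^ (q ℕ.^ toℕ i))
    where open QLinearPolynomial L

  _′⟨_⟩ : QLinearPolynomial → Carrier → Carrier
  L ′⟨ x ⟩ = ∑[ i < terms ] iterate frobenius⁻¹ (coeff i * x) (toℕ i)
    where open QLinearPolynomial L

  -- A polynomial enters only through the map it induces.
  IsPermutationPolynomial : (Carrier → Carrier) → Set _
  IsPermutationPolynomial = Bijective _≈_ _≈_

{-# OPTIONS --safe #-}

-- Let t be the trace of F = 𝔽_{qⁿ} over 𝔽₂ and χ = (−1)^t. By orthogonality of the characters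
-- x ↦ χ(u x), a map f permutes F if and only if ∑ₓ χ(u f(x)) = 0 for all u ≠ 0. With a = L₀′(u)
-- and b = L₁′(u), taking adjoints turns t(u f(x)) into t(Q(x)) for
-- Q(x) = a x^(2^l) + b x Tr(x), a quadratic form over 𝔽₂ whose radical is the kernel of
-- ρ(w) = b Tr(w) + Tr(b w). The sum ∑ₓ χ(Q(x)) vanishes if and only if t ∘ Q is not identically
-- zero on the radical. If b ∈ 𝔽_q the radical is all of F and t(Q(x)) = t((a² + b^(2^l)) x^(2^(l+1)));
-- otherwise the radical is {w | Tr(w) = Tr(b w) = 0}, where t(Q(w)) = t(a w^(2^l)), and by duality
-- of trace forms this is nonzero somewhere if and only if a is not in the 𝔽_q-span of 1 and b^(2^l).
module Submission where

open import Algebra.Apartness.Bundles using (HeytingField)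
open import Algebra.Bundles using (CommutativeMonoid; RawRing)
open import Algebra.Morphism.Structures using (module RingMorphisms)
import Algebra.Properties.CommutativeMonoid.Sum as CommutativeMonoidSum
import Algebra.Properties.CommutativeSemiring.Exp as CommutativeSemiringExp
import Algebra.Properties.Semiring.Mult as SemiringMult
import Algebra.Properties.Semiring.Sum as SemiringSum
import Algebra.Solver.Ring as RingSolver
open import Algebra.Solver.Ring.AlmostCommutativeRing
  using (AlmostCommutativeRing; fromCommutativeSemiring; _-Raw-AlmostCommutative⟶_)
open import Data.Bool.Base using (Bool; true; false; _xor_; _∧_)
open import Data.Fin.Base using (Fin; zero; suc; toℕ; inject≤; punchOut)
open import Data.Fin.Permutation using (Permutation′)
import Data.Fin.Properties as Fin
open import Data.Integer.Base as ℤ using (ℤ; 0ℤ; 1ℤ; -1ℤ)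
import Data.Integer.Properties as ℤ
open import Data.Maybe.Base using (Maybe; just; nothing)
open import Data.Nat.Base as ℕ using (ℕ; NonZero; zero; suc; z<s; s<s; z≤n)
open import Data.Nat.GeneralisedArithmetic using (iterate)
import Data.Nat.Properties as ℕ
open import Data.Product.Base using (_×_; _,_; ∃; proj₁; proj₂)
open import Data.Sum.Base using (_⊎_; inj₁; inj₂)
open import Data.Vec.Functional using (_∷_; []; Vector; replicate)
open import Function.Base using (_∘_; id; const)
open import Function.Bundles using (_⇔_; mk⇔; Inverse)
import Function.Construct.Composition as Composition
import Function.Construct.Symmetry as Symmetry
open import Function.Definitions using (Injective; Bijective)
open import Function.Properties.Bijection using (Bijection⇒Inverse)
open import Level using (Level; _⊔_)
open import Relation.Binary.Core using (_Preserves_⟶_)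
open import Relation.Binary.Definitions using (_Respects_)
open import Relation.Binary.PropositionalEquality as ≡ using (_≡_)
open import Relation.Nullary using (¬_; Dec; yes; no; contradiction; ¬?; _×-dec_)
open import Relation.Nullary.Decidable using (map′; decidable-stable)
open import Defs

-- Pigeonhole on finite sets and positivity of integer sums.

-- If j were missed, removing it from the codomain would leave an injection of n + 1 elements into
-- n.
Fin-injective⇒surjective : ∀ {n} {f : Fin n → Fin n} → Injective _≡_ _≡_ f → ∀ j → ∃ λ i → f i ≡ j
Fin-injective⇒surjective {suc n} {f} inj j with Fin.any? (λ i → f i Fin.≟ j)
... | yes hit  = hit
... | no  miss = contradiction
  (Fin.injective⇒≤ {f = λ i → punchOut {i = j} {j = f i} (λ j≡fi → miss (i , ≡.sym j≡fi))}
    (λ eq → inj (Fin.punchOut-injective {i = j} _ _ eq)))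
  (ℕ.<⇒≱ (ℕ.n<1+n n))

module ∑ℤ = SemiringSum ℤ.+-*-semiring

sum-nonnegative : ∀ {r} (v : Vector ℤ r) → (∀ i → 0ℤ ℤ.≤ v i) → 0ℤ ℤ.≤ ∑ℤ.sum v
sum-nonnegative {zero}  v v≥0 = ℤ.≤-refl
sum-nonnegative {suc r} v v≥0 = ℤ.+-mono-≤ (v≥0 zero) (sum-nonnegative (v ∘ suc) (v≥0 ∘ suc))

sum-positive : ∀ {r} (v : Vector ℤ r) → (∀ i → 0ℤ ℤ.≤ v i) → ∀ j → 0ℤ ℤ.< v j → 0ℤ ℤ.< ∑ℤ.sum v
sum-positive v v≥0 zero    vⱼ>0 = ℤ.+-mono-<-≤ vⱼ>0 (sum-nonnegative (v ∘ suc) (v≥0 ∘ suc))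
sum-positive v v≥0 (suc j) vⱼ>0 = ℤ.+-mono-≤-< (v≥0 zero) (sum-positive (v ∘ suc) (v≥0 ∘ suc) j vⱼ>0)

i≡-i⇒i≡0 : ∀ {i} → i ≡ ℤ.- i → i ≡ 0ℤ
i≡-i⇒i≡0 {ℤ.+ zero} _ = ≡.refl

-- Finite fields of order 2^k: decidability, counting and arithmetic.

module FiniteFieldOfCharacteristic2
  {c ℓ₁ ℓ₂ : Level} (F : HeytingField c ℓ₁ ℓ₂) {N : ℕ} (k : ℕ) (N≡2^k : N ≡ 2 ℕ.^ k)
  (enum : HasCardinality (FieldOps.setoid F) N) where

  open HeytingField F using (tight; heytingCommutativeRing)
  open FieldOps F hiding (zero)
  open import Algebra.Apartness.Properties.HeytingCommutativeRing heytingCommutativeRing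
    using (x#0y#0→xy#0; 1#0)
  open CommutativeMonoidSum +-commutativeMonoid using (sum-cong-≋; sum-init-last; sum-replicate; ∑-distrib-+)
  open SemiringMult semiring using (×1-homo-*) renaming (_×_ to _·_)
  open import Algebra.Properties.Group +-group using (identityˡ-unique)
  open import Relation.Binary.Reasoning.Setoid setoid
  open Inverse enum public
    using () renaming (to to elem; from to index; from-cong to index-cong;
                       strictlyInverseˡ to elem-index; strictlyInverseʳ to index-elem)

  infix 4 _≟_

  _≟_ : ∀ x y → Dec (x ≈ y)
  x ≟ y = map′
    (λ eq → trans (sym (elem-index x)) (trans (reflexive (≡.cong elem eq)) (elem-index y)))
    index-cong (index x Fin.≟ index y)

  search : ∀ {p} {P : Carrier → Set p} → P Respects _≈_ → (∀ x → Dec (P x)) → Dec (∃ P)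
  search resp P? = map′ (λ (i , p) → elem i , p)
    (λ (x , p) → index x , resp (sym (elem-index x)) p) (Fin.any? (P? ∘ elem))

  elem-injective : Injective _≡_ _≈_ elem
  elem-injective {i} {j} eq = ≡.trans (≡.sym (index-elem i)) (≡.trans (index-cong eq) (index-elem j))

  injective⇒strictlySurjective : ∀ {f} → f Preserves _≈_ ⟶ _≈_ → Injective _≈_ _≈_ f →
                                 ∀ y → ∃ λ x → f x ≈ y
  injective⇒strictlySurjective {f} f-cong inj y =
    let i , eq = Fin-injective⇒surjective {f = index ∘ f ∘ elem} index∘f∘elem-injective (index y)
    in elem i , index-injective eq
    where
    index-injective : Injective _≈_ _≡_ index
    index-injective {a} {b} eq = trans (sym (elem-index a)) (trans (reflexive (≡.cong elem eq)) (elem-index b))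
    index∘f∘elem-injective : Injective _≡_ _≡_ (index ∘ f ∘ elem)
    index∘f∘elem-injective = elem-injective ∘ inj ∘ index-injective

  -- A section g of f is injective, hence surjective by counting, so it is a two-sided inverse of f.
  strictlySurjective⇒injective : ∀ {f} → f Preserves _≈_ ⟶ _≈_ → (∀ y → ∃ λ x → f x ≈ y) →
                                 Injective _≈_ _≈_ f
  strictlySurjective⇒injective {f} f-cong surj {x} {y} fx≈fy = begin
    x             ≈⟨ gf≈id x ⟨
    g (f x)       ≈⟨ g-cong fx≈fy ⟩
    g (f y)       ≈⟨ gf≈id y ⟩
    y             ∎
    where
    g : Carrier → Carrier
    -- The preimage is chosen for the canonical representative of y, which makes g respect `_≈_`.
    g y = proj₁ (surj (elem (index y)))
    fg≈id : ∀ y → f (g y) ≈ y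
    fg≈id y = trans (proj₂ (surj (elem (index y)))) (elem-index y)
    g-cong : g Preserves _≈_ ⟶ _≈_
    g-cong y≈z = reflexive (≡.cong (proj₁ ∘ surj ∘ elem) (index-cong y≈z))
    g-surj : ∀ x → ∃ λ y → g y ≈ x
    g-surj = injective⇒strictlySurjective g-cong λ {a} {b} eq →
      trans (sym (fg≈id a)) (trans (f-cong eq) (fg≈id b))
    gf≈id : ∀ x → g (f x) ≈ x
    gf≈id x = let y , gy≈x = g-surj x in begin
      g (f x)        ≈⟨ g-cong (f-cong gy≈x) ⟨
      g (f (g y))    ≈⟨ g-cong (fg≈id y) ⟩
      g y            ≈⟨ gy≈x ⟩
      x              ∎

  1≉0 : ¬ 1# ≈ 0#
  1≉0 1≈0 = proj₂ (tight _ _) 1≈0 1#0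

  zero-product : ∀ {x y} → ¬ x ≈ 0# → x * y ≈ 0# → y ≈ 0#
  zero-product {x} {y} x≉0 xy≈0 = decidable-stable (y ≟ 0#) λ y≉0 →
    x≉0 (proj₁ (tight _ _) λ x#0 → y≉0 (proj₁ (tight _ _) λ y#0 →
      proj₂ (tight _ _) xy≈0 (x#0y#0→xy#0 x#0 y#0)))

  module SumOver {a ℓ} (M : CommutativeMonoid a ℓ) where
    open CommutativeMonoid M using () renaming (Carrier to A; _≈_ to _≈ᴹ_; sym to symᴹ; trans to transᴹ)
    open CommutativeMonoidSum M using (sum-permute) renaming (sum to sumᴹ; sum-cong-≋ to sumᴹ-cong)

    ∑ : (Carrier → A) → A
    ∑ g = sumᴹ (g ∘ elem)

    ∑-reindex : ∀ {g} → g Preserves _≈_ ⟶ _≈ᴹ_ → (f : Inverse setoid setoid) →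
                ∑ (g ∘ Inverse.to f) ≈ᴹ ∑ g
    ∑-reindex {g} g-cong f = symᴹ (transᴹ (sum-permute (g ∘ elem) π)
      (sumᴹ-cong λ i → g-cong (elem-index (Inverse.to f (elem i)))))
      where
      π : Permutation′ N
      π = Composition.inverse (Composition.inverse enum f) (Symmetry.inverse enum)

  translation : Carrier → Inverse setoid setoid
  translation y = record
    { to        = _+ y
    ; from      = _- y
    ; to-cong   = +-congʳ
    ; from-cong = +-congʳ
    ; inverse   = (λ {x} {z} z≈x-y → trans (+-congʳ z≈x-y) (trans (+-assoc x (- y) y)
                    (trans (+-congˡ (-‿inverseˡ y)) (+-identityʳ x))))
                , (λ {x} {z} z≈x+y → trans (+-congʳ z≈x+y) (trans (+-assoc x y (- y))
                    (trans (+-congˡ (-‿inverseʳ y)) (+-identityʳ x))))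
    }

  private
    -- Translation by 1 permutes the field, so adding N · 1 leaves the sum of all elements
    -- unchanged.
    N·1≈0 : N · 1# ≈ 0#
    N·1≈0 = identityˡ-unique (N · 1#) (∑ id) (begin
      N · 1# + ∑ id              ≈⟨ +-comm _ _ ⟩
      ∑ id + N · 1#              ≈⟨ +-congˡ (sum-replicate N) ⟨
      ∑ id + sum (replicate N 1#) ≈⟨ ∑-distrib-+ elem (replicate N 1#) ⟨
      ∑ (_+ 1#)                  ≈⟨ ∑-reindex {g = id} id (translation 1#) ⟩
      ∑ id                       ∎)
      where
      open SumOver +-commutativeMonoid

    2^j·1≉0 : ¬ 2 · 1# ≈ 0# → ∀ j → ¬ (2 ℕ.^ j) · 1# ≈ 0#
    2^j·1≉0 2≉0 zero    eq = 1≉0 (trans (sym (+-identityʳ 1#)) eq)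
    2^j·1≉0 2≉0 (suc j) eq =
      2^j·1≉0 2≉0 j (zero-product 2≉0 (trans (sym (×1-homo-* 2 (2 ℕ.^ j))) eq))

  -- Were 2 nonzero, every power of 2 would be nonzero, as there are no zero divisors; but N = 2^k
  -- annihilates 1.
  1+1≈0 : 1# + 1# ≈ 0#
  1+1≈0 = trans (+-congˡ (sym (+-identityʳ 1#)))
    (decidable-stable (2 · 1# ≟ 0#) λ 2≉0 →
      2^j·1≉0 2≉0 k (trans (reflexive (≡.cong (_· 1#) (≡.sym N≡2^k))) N·1≈0))

  x+x≈0 : ∀ x → x + x ≈ 0#
  x+x≈0 x = begin
    x + x            ≈⟨ +-cong (*-identityˡ x) (*-identityˡ x) ⟨
    1# * x + 1# * x  ≈⟨ distribʳ x 1# 1# ⟨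
    (1# + 1#) * x    ≈⟨ *-congʳ 1+1≈0 ⟩
    0# * x           ≈⟨ zeroˡ x ⟩
    0#               ∎

  private
    -- Coefficients in 𝔽₂ let the ring solver cancel x + x, so that it proves identities special to
    -- characteristic 2; negation is the identity.
    𝔽₂ : RawRing _ _
    𝔽₂ = record { Carrier = Bool ; _≈_ = _≡_ ; _+_ = _xor_ ; _*_ = _∧_ ; -_ = id ; 0# = false ; 1# = true }

    almostCommutativeRing : AlmostCommutativeRing _ _
    almostCommutativeRing = fromCommutativeSemiring commutativeSemiring

    ⟦_⟧ : Bool → Carrier
    ⟦ true  ⟧ = 1#
    ⟦ false ⟧ = 0#

    𝔽₂⟶F : 𝔽₂ -Raw-AlmostCommutative⟶ almostCommutativeRing
    𝔽₂⟶F = record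
      { ⟦_⟧    = ⟦_⟧
      ; +-homo = λ { true true → sym 1+1≈0 ; true false → sym (+-identityʳ 1#) ; false y → sym (+-identityˡ _) }
      ; *-homo = λ { true y → sym (*-identityˡ _) ; false y → sym (zeroˡ _) }
      ; -‿homo = λ _ → refl
      ; 0-homo = refl
      ; 1-homo = refl
      }

    coeff≟ : ∀ a b → Maybe (⟦ a ⟧ ≈ ⟦ b ⟧)
    coeff≟ true  true  = just refl
    coeff≟ false false = just refl
    coeff≟ _     _     = nothing

  module Solver = RingSolver 𝔽₂ almostCommutativeRing 𝔽₂⟶F coeff≟
  open Solver using (solve; con; _:=_; _:+_; _:*_; _:^_)

  x+y≈0⇒x≈y : ∀ {x y} → x + y ≈ 0# → x ≈ y
  x+y≈0⇒x≈y {x} {y} eq = begin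
    x            ≈⟨ solve 2 (λ x y → x := (x :+ y) :+ y) refl x y ⟩
    x + y + y    ≈⟨ +-congʳ eq ⟩
    0# + y       ≈⟨ +-identityˡ y ⟩
    y            ∎

  *-cancelˡ : ∀ {x y z} → ¬ x ≈ 0# → x * y ≈ x * z → y ≈ z
  *-cancelˡ {x} {y} {z} x≉0 eq = x+y≈0⇒x≈y (zero-product x≉0 (begin
    x * (y + z)    ≈⟨ distribˡ x y z ⟩
    x * y + x * z  ≈⟨ +-congʳ eq ⟩
    x * z + x * z  ≈⟨ x+x≈0 _ ⟩
    0#             ∎))

  -- An injective multiplication map on a finite set is onto, so quotients exist from a mere negated
  -- equality, with no apartness witness.
  divide : ∀ {x} → ¬ x ≈ 0# → ∀ y → ∃ λ z → x * z ≈ y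
  divide x≉0 = injective⇒strictlySurjective *-congˡ (*-cancelˡ x≉0)

  Additive : (Carrier → Carrier) → Set _
  Additive φ = ∀ x y → φ (x + y) ≈ φ x + φ y

  additive-0 : ∀ {φ} → φ Preserves _≈_ ⟶ _≈_ → Additive φ → φ 0# ≈ 0#
  additive-0 {φ} φ-cong φ-+ = begin
    φ 0#         ≈⟨ φ-cong (+-identityˡ 0#) ⟨
    φ (0# + 0#)  ≈⟨ φ-+ 0# 0# ⟩
    φ 0# + φ 0#  ≈⟨ x+x≈0 (φ 0#) ⟩
    0#           ∎

  additive-sum : ∀ {φ} → φ Preserves _≈_ ⟶ _≈_ → Additive φ →
                 ∀ {r} (v : Vector Carrier r) → φ (sum v) ≈ sum (φ ∘ v)
  additive-sum φ-cong φ-+ {zero}  v = additive-0 φ-cong φ-+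
  additive-sum φ-cong φ-+ {suc r} v =
    trans (φ-+ _ _) (+-congˡ (additive-sum φ-cong φ-+ (v ∘ suc)))

  x^2≈x*x : ∀ x → x ^ 2 ≈ x * x
  x^2≈x*x x = *-congˡ (*-identityʳ x)

  -- Squaring is additive because the cross term 2xy vanishes; iterate.
  ^2^-+ : ∀ j → Additive (_^ (2 ℕ.^ j))
  ^2^-+ zero    x y = solve 2 (λ x y → (x :+ y) :* con true := x :* con true :+ y :* con true) refl x y
  ^2^-+ (suc j) x y = begin
    (x + y) ^ (2 ℕ.* 2 ℕ.^ j)      ≈⟨ ^-assocʳ (x + y) 2 (2 ℕ.^ j) ⟨
    ((x + y) ^ 2) ^ 2 ℕ.^ j
      ≈⟨ ^-congˡ (2 ℕ.^ j) (solve 2 (λ x y → (x :+ y) :^ 2 := x :^ 2 :+ y :^ 2) refl x y) ⟩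
    (x ^ 2 + y ^ 2) ^ 2 ℕ.^ j      ≈⟨ ^2^-+ j (x ^ 2) (y ^ 2) ⟩
    (x ^ 2) ^ 2 ℕ.^ j + (y ^ 2) ^ 2 ℕ.^ j ≈⟨ +-cong (^-assocʳ x 2 (2 ℕ.^ j)) (^-assocʳ y 2 (2 ℕ.^ j)) ⟩
    x ^ (2 ℕ.* 2 ℕ.^ j) + y ^ (2 ℕ.* 2 ℕ.^ j) ∎

  x^j≈0⇒x≈0 : ∀ j {x} → x ^ j ≈ 0# → x ≈ 0#
  x^j≈0⇒x≈0 zero    1≈0    = contradiction 1≈0 1≉0
  x^j≈0⇒x≈0 (suc j) {x} eq = decidable-stable (x ≟ 0#) λ x≉0 →
    x≉0 (x^j≈0⇒x≈0 j (zero-product x≉0 eq))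

  ^2^-injective : ∀ j → Injective _≈_ _≈_ (_^ (2 ℕ.^ j))
  ^2^-injective j {x} {y} eq = x+y≈0⇒x≈y (x^j≈0⇒x≈0 (2 ℕ.^ j)
    (trans (^2^-+ j x y) (trans (+-congʳ eq) (x+x≈0 _))))

  ^2^-root : ∀ j y → ∃ λ x → x ^ (2 ℕ.^ j) ≈ y
  ^2^-root j = injective⇒strictlySurjective (^-congˡ (2 ℕ.^ j)) (^2^-injective j)

  ^-comm : ∀ x i j → (x ^ i) ^ j ≈ (x ^ j) ^ i
  ^-comm x i j = trans (^-assocʳ x i j) (trans (^-congʳ x (ℕ.*-comm i j)) (sym (^-assocʳ x j i)))

  -- Polynomial functions and the bound on their number of roots.

  -- Poly a d f: f is given by a polynomial of degree at most d whose coefficient of x^d is a.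
  data Poly (a : Carrier) : ℕ → (Carrier → Carrier) → Set (c ⊔ ℓ₁) where
    constant : ∀ {f} → (∀ x → f x ≈ a) → Poly a 0 f
    horner   : ∀ {d f g} b → Poly a d g → (∀ x → f x ≈ b + x * g x) → Poly a (suc d) f

  poly-cong : ∀ {a b d f g} → a ≈ b → (∀ x → g x ≈ f x) → Poly a d f → Poly b d g
  poly-cong a≈b g≈f (constant f≈a)   = constant λ x → trans (g≈f x) (trans (f≈a x) a≈b)
  poly-cong a≈b g≈f (horner e p eq)  =
    horner e (poly-cong a≈b (λ _ → refl) p) λ x → trans (g≈f x) (eq x)

  poly-+ : ∀ {a b d f g} → Poly a d f → Poly b d g → Poly (a + b) d (λ x → f x + g x)
  poly-+ (constant f≈a)   (constant g≈b)    = constant λ x → +-cong (f≈a x) (g≈b x)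
  poly-+ (horner e p eq) (horner e′ p′ eq′) = horner (e + e′) (poly-+ p p′) λ x →
    trans (+-cong (eq x) (eq′ x))
      (solve 5 (λ e e′ x y z → (e :+ x :* y) :+ (e′ :+ x :* z) := (e :+ e′) :+ x :* (y :+ z))
        refl e e′ x _ _)

  poly-0 : ∀ d → Poly 0# d (const 0#)
  poly-0 zero    = constant λ _ → refl
  poly-0 (suc d) = horner 0# (poly-0 d) λ x → sym (trans (+-identityˡ _) (zeroʳ x))

  -- The formal degree is raised by padding with zero leading coefficients.
  poly-< : ∀ {a d e f} → d ℕ.< e → Poly a d f → Poly 0# e f
  poly-< {e = suc e} z<s (constant f≈a)  = horner _ (poly-0 e) λ x →
    trans (f≈a x) (sym (trans (+-congˡ (zeroʳ x)) (+-identityʳ _)))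
  poly-< (s<s d<e) (horner b p eq)       = horner b (poly-< d<e p) eq

  poly-^ : ∀ d → Poly 1# d (_^ d)
  poly-^ zero    = constant λ _ → refl
  poly-^ (suc d) = horner 0# (poly-^ d) λ x → sym (+-identityˡ _)

  poly-^-sum : ∀ {d r} (e : Fin r → ℕ) → (∀ i → e i ℕ.< d) → Poly 0# d (λ x → sum (λ i → x ^ e i))
  poly-^-sum {d} {zero}  e e<d = poly-0 d
  poly-^-sum {d} {suc r} e e<d = poly-cong (+-identityˡ 0#) (λ _ → refl)
    (poly-+ (poly-< (e<d zero) (poly-^ (e zero))) (poly-^-sum (e ∘ suc) (e<d ∘ suc)))

  -- The factor theorem by synthetic division; in characteristic 2 the sums stand for differences.
  -- The quotient keeps the leading coefficient a.
  poly-quotient : ∀ {a d f} → Poly a (suc d) f → ∀ r →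
                  ∃ λ h → Poly a d h × (∀ x → f x + f r ≈ (x + r) * h x)
  poly-quotient (horner {g = g} b p@(constant g≈a) f≈) r = g , p , λ x → begin
    _ + _                              ≈⟨ +-cong (f≈ x) (f≈ r) ⟩
    (b + x * g x) + (b + r * g r)      ≈⟨ +-congˡ (+-congˡ (*-congˡ (trans (g≈a r) (sym (g≈a x))))) ⟩
    (b + x * g x) + (b + r * g x)
      ≈⟨ solve 4 (λ b x r y → (b :+ x :* y) :+ (b :+ r :* y) := (x :+ r) :* y) refl b x r (g x) ⟩
    (x + r) * g x                      ∎
  poly-quotient {a} (horner {g = g} b p@(horner _ _ _) f≈) r =
    let h , h-poly , g≈ = poly-quotient p r in
    (λ x → g r + x * h x) , horner (g r) h-poly (λ _ → refl) , λ x → begin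
    _ + _                              ≈⟨ +-cong (f≈ x) (f≈ r) ⟩
    (b + x * g x) + (b + r * g r)
      ≈⟨ solve 5 (λ b x r y z → (b :+ x :* y) :+ (b :+ r :* z) := x :* (y :+ z) :+ (x :+ r) :* z)
        refl b x r (g x) (g r) ⟩
    x * (g x + g r) + (x + r) * g r    ≈⟨ +-congʳ (*-congˡ (g≈ x)) ⟩
    x * ((x + r) * h x) + (x + r) * g r
      ≈⟨ solve 4 (λ x r y z → x :* ((x :+ r) :* y) :+ (x :+ r) :* z := (x :+ r) :* (z :+ x :* y))
        refl x r (h x) (g r) ⟩
    (x + r) * (g r + x * h x)          ∎

  -- Divide by x + r₀: the other d points differ from r₀, hence are roots of the quotient, which has
  -- the same nonzero leading coefficient.
  poly-roots : ∀ {a d f} → ¬ a ≈ 0# → Poly a d f → (r : Fin (suc d) → Carrier) →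
               Injective _≡_ _≈_ r → ¬ (∀ i → f (r i) ≈ 0#)
  poly-roots a≉0 (constant f≈a) r inj f≈0 = a≉0 (trans (sym (f≈a (r zero))) (f≈0 zero))
  poly-roots {f = f} a≉0 p@(horner _ _ _) r inj f≈0 =
    let h , h-poly , f≈ = poly-quotient p (r zero) in
    poly-roots a≉0 h-poly (r ∘ suc) (Fin.suc-injective ∘ inj) λ i →
      zero-product (λ eq → contradiction (inj (x+y≈0⇒x≈y eq)) λ ()) (begin
        (r (suc i) + r zero) * h (r (suc i))  ≈⟨ f≈ (r (suc i)) ⟨
        f (r (suc i)) + f (r zero)            ≈⟨ +-cong (f≈0 (suc i)) (f≈0 zero) ⟩
        0# + 0#                               ≈⟨ +-identityˡ 0# ⟩
        0#                                    ∎)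

  -- Trace maps as polynomial functions.

  -- One formula serves the whole tower: (s , r) = (m , n) gives `Tr`, and (1 , m) gives the
  -- absolute trace of 𝔽_q, evaluated inside the larger field.
  partialTrace : ℕ → ℕ → Carrier → Carrier
  partialTrace s r x = sum {r} (λ i → x ^ ((2 ℕ.^ s) ℕ.^ toℕ i))

  ^-^2^-+ : ∀ s i → Additive (_^ ((2 ℕ.^ s) ℕ.^ i))
  ^-^2^-+ s i x y rewrite ℕ.^-*-assoc 2 s i = ^2^-+ (s ℕ.* i) x y

  partialTrace-cong : ∀ s r → partialTrace s r Preserves _≈_ ⟶ _≈_
  partialTrace-cong s r eq = sum-cong-≋ {r} λ i → ^-congˡ ((2 ℕ.^ s) ℕ.^ toℕ i) eq

  partialTrace-+ : ∀ s r → Additive (partialTrace s r)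
  partialTrace-+ s r x y = trans (sum-cong-≋ {r} λ i → ^-^2^-+ s (toℕ i) x y)
    (∑-distrib-+ {r} (λ i → x ^ ((2 ℕ.^ s) ℕ.^ toℕ i)) _)

  partialTrace-^2^ : ∀ s r j x → partialTrace s r (x ^ (2 ℕ.^ j)) ≈ partialTrace s r x ^ (2 ℕ.^ j)
  partialTrace-^2^ s r j x = begin
    partialTrace s r (x ^ (2 ℕ.^ j))
      ≈⟨ sum-cong-≋ {r} (λ i → ^-comm x (2 ℕ.^ j) ((2 ℕ.^ s) ℕ.^ toℕ i)) ⟩
    sum {r} (λ i → (x ^ ((2 ℕ.^ s) ℕ.^ toℕ i)) ^ (2 ℕ.^ j))
      ≈⟨ additive-sum (^-congˡ (2 ℕ.^ j)) (^2^-+ j) {r} _ ⟨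
    partialTrace s r x ^ (2 ℕ.^ j)                             ∎

  partialTrace-last : ∀ s r x →
    partialTrace s (suc r) x ≈ partialTrace s r x + x ^ ((2 ℕ.^ s) ℕ.^ r)
  partialTrace-last s r x = trans (sum-init-last {r} (λ i → x ^ ((2 ℕ.^ s) ℕ.^ toℕ i)))
    (+-cong (sum-cong-≋ {r} λ i → ^-congʳ x (≡.cong ((2 ℕ.^ s) ℕ.^_) (Fin.toℕ-inject₁ i)))
            (^-congʳ x (≡.cong ((2 ℕ.^ s) ℕ.^_) (Fin.toℕ-fromℕ r))))

  -- Raising to the power Q shifts the summands by one place, and the end terms x and x^(Q^r) agree
  -- by hypothesis.
  partialTrace-fixed : ∀ s r {x} → x ^ ((2 ℕ.^ s) ℕ.^ r) ≈ x →
                       partialTrace s r x ^ (2 ℕ.^ s) ≈ partialTrace s r x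
  partialTrace-fixed s r {x} fixed = sym (begin
    T                            ≈⟨ solve 2 (λ y z → y := z :+ (y :+ z)) refl T x ⟩
    x + (T + x)                  ≈⟨ +-congˡ (+-congˡ fixed) ⟨
    x + (T + x ^ (Q ℕ.^ r))      ≈⟨ +-congˡ (partialTrace-last s r x) ⟨
    x + (x ^ 1 + sum {r} (λ i → x ^ (Q ℕ.^ suc (toℕ i))))
                                 ≈⟨ solve 2 (λ y z → y :+ (y :^ 1 :+ z) := z) refl x _ ⟩
    sum {r} (λ i → x ^ (Q ℕ.* Q ℕ.^ toℕ i))
                                 ≈⟨ sum-cong-≋ {r} (λ i → ^-assocʳ x Q (Q ℕ.^ toℕ i)) ⟨
    partialTrace s r (x ^ Q)     ≈⟨ partialTrace-^2^ s r s x ⟩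
    T ^ Q                        ∎)
    where
    T = partialTrace s r x
    Q = 2 ℕ.^ s

  -- With Q = 2^s, the trace is monic of degree Q^(r-1), too small to vanish at Q^r distinct points.
  -- The points form an arbitrary family so that they may be the elements of 𝔽_q inside F.
  partialTrace-≉0 : ∀ s r → .{{NonZero s}} → .{{NonZero r}} →
                    (e : Fin ((2 ℕ.^ s) ℕ.^ r) → Carrier) → Injective _≡_ _≈_ e →
                    ∃ λ i → ¬ partialTrace s r (e i) ≈ 0#
  partialTrace-≉0 s@(suc s-1) (suc r) e inj = Fin.¬∀⟶∃¬ _ _ (λ i → partialTrace s (suc r) (e i) ≟ 0#) λ T≈0 →
    -- `degree<` unfolds to (2^s)^r + 1 ≤ (2^s)^(r+1), which leaves room for one point more than the
    -- degree.
    poly-roots 1≉0 poly (λ i → e (inject≤ i degree<)) (Fin.inject≤-injective _ _ _ _ ∘ inj)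
      (λ i → T≈0 (inject≤ i degree<))
    where
    1<Q : 1 ℕ.< 2 ℕ.^ s
    1<Q = ℕ.^-monoʳ-< 2 (s<s z<s) {0} {s} z<s
    degree< : (2 ℕ.^ s) ℕ.^ r ℕ.< (2 ℕ.^ s) ℕ.^ suc r
    degree< = ℕ.^-monoʳ-< (2 ℕ.^ s) 1<Q (ℕ.n<1+n r)
    poly : Poly 1# ((2 ℕ.^ s) ℕ.^ r) (partialTrace s (suc r))
    poly = poly-cong (+-identityˡ 1#) (partialTrace-last s r)
      (poly-+ (poly-^-sum {r = r} (λ i → (2 ℕ.^ s) ℕ.^ toℕ i) (λ i → ℕ.^-monoʳ-< (2 ℕ.^ s) 1<Q (Fin.toℕ<n i)))
              (poly-^ ((2 ℕ.^ s) ℕ.^ r)))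

-- Sign characters of a finite field and their orthogonality.

module AdditiveCharacter
  {c ℓ₁ ℓ₂ : Level} (F : HeytingField c ℓ₁ ℓ₂) {N : ℕ} (k : ℕ) (N≡2^k : N ≡ 2 ℕ.^ k)
  (enum : HasCardinality (FieldOps.setoid F) N)
  (t : FieldOps.Carrier F → FieldOps.Carrier F)
  (t-cong : t Preserves FieldOps._≈_ F ⟶ FieldOps._≈_ F)
  (t-+ : FiniteFieldOfCharacteristic2.Additive F k N≡2^k enum t)
  (t-bit : ∀ x → FieldOps._≈_ F (t x) (FieldOps.0# F) ⊎ FieldOps._≈_ F (t x) (FieldOps.1# F))
  (t-≉0 : ∃ λ θ → ¬ FieldOps._≈_ F (t θ) (FieldOps.0# F)) where

  open FieldOps F hiding (zero)
  open FiniteFieldOfCharacteristic2 F k N≡2^k enum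
  open SumOver ℤ.+-0-commutativeMonoid
  open ≡.≡-Reasoning

  t0≈0 : t 0# ≈ 0#
  t0≈0 = additive-0 t-cong t-+

  ∑-positive : ∀ {g} → (∀ x → 0ℤ ℤ.≤ g x) → g Preserves _≈_ ⟶ _≡_ → ∀ y → 0ℤ ℤ.< g y → 0ℤ ℤ.< ∑ g
  ∑-positive {g} g≥0 g-cong y gy>0 = sum-positive (g ∘ elem) (g≥0 ∘ elem) (index y)
    (≡.subst (0ℤ ℤ.<_) (g-cong (sym (elem-index y))) gy>0)

  |F|>0 : 0ℤ ℤ.< ∑ (const 1ℤ)
  |F|>0 = ∑-positive (λ _ → ℤ.+≤+ z≤n) (λ _ → ≡.refl) 0# (ℤ.+<+ z<s)

  χ : Carrier → ℤ
  χ x with t x ≟ 0#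
  ... | yes _ = 1ℤ
  ... | no  _ = -1ℤ

  χ≡1 : ∀ {x} → t x ≈ 0# → χ x ≡ 1ℤ
  χ≡1 {x} tx≈0 with t x ≟ 0#
  ... | yes _    = ≡.refl
  ... | no  tx≉0 = contradiction tx≈0 tx≉0

  χ≡-1 : ∀ {x} → ¬ t x ≈ 0# → χ x ≡ -1ℤ
  χ≡-1 {x} tx≉0 with t x ≟ 0#
  ... | yes tx≈0 = contradiction tx≈0 tx≉0
  ... | no  _    = ≡.refl

  -- Serves to transport χ along adjoint identities, which hold only after applying `t`.
  χ-resp-t : ∀ {x y} → t x ≈ t y → χ x ≡ χ y
  χ-resp-t {x} {y} tx≈ty with t x ≟ 0#
  ... | yes tx≈0 = ≡.sym (χ≡1 (trans (sym tx≈ty) tx≈0))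
  ... | no  tx≉0 = ≡.sym (χ≡-1 (tx≉0 ∘ trans tx≈ty))

  χ-cong : χ Preserves _≈_ ⟶ _≡_
  χ-cong = χ-resp-t ∘ t-cong

  χ-+ : ∀ x y → χ (x + y) ≡ χ x ℤ.* χ y
  χ-+ x y with t x ≟ 0# | t y ≟ 0#
  ... | yes tx≈0 | yes ty≈0 = χ≡1 (trans (t-+ x y) (trans (+-cong tx≈0 ty≈0) (+-identityˡ 0#)))
  ... | yes tx≈0 | no  ty≉0 = χ≡-1 λ eq → ty≉0 (trans (sym (trans (t-+ x y) (trans (+-congʳ tx≈0) (+-identityˡ _)))) eq)
  ... | no  tx≉0 | yes ty≈0 = χ≡-1 λ eq → tx≉0 (trans (sym (trans (t-+ x y) (trans (+-congˡ ty≈0) (+-identityʳ _)))) eq)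
  ... | no  tx≉0 | no  ty≉0 = χ≡1 (trans (t-+ x y) (trans (+-cong (t≈1 tx≉0) (t≈1 ty≉0)) 1+1≈0))
    where
    t≈1 : ∀ {x} → ¬ t x ≈ 0# → t x ≈ 1#
    t≈1 {x} tx≉0 with t-bit x
    ... | inj₁ tx≈0 = contradiction tx≈0 tx≉0
    ... | inj₂ tx≈1 = tx≈1

  χ²≡1 : ∀ x → χ x ℤ.* χ x ≡ 1ℤ
  χ²≡1 x with t x ≟ 0#
  ... | yes _ = ≡.refl
  ... | no  _ = ≡.refl

  -- Translation by w permutes the summands while negating each, so the sum is its own negative.
  ∑-anti-invariant : ∀ {g} → g Preserves _≈_ ⟶ _≡_ → ∀ w → (∀ x → g (x + w) ≡ ℤ.- g x) → ∑ g ≡ 0ℤ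
  ∑-anti-invariant {g} g-cong w anti = i≡-i⇒i≡0 (begin
    ∑ g                    ≡⟨ ∑-reindex g-cong (translation w) ⟨
    ∑ (λ x → g (x + w))    ≡⟨ ∑ℤ.sum-cong-≗ (λ i → ≡.trans (anti (elem i)) (≡.sym (ℤ.-1*i≡-i _))) ⟩
    ∑ (λ x → -1ℤ ℤ.* g x)  ≡⟨ ∑ℤ.*-distribˡ-sum -1ℤ (g ∘ elem) ⟨
    -1ℤ ℤ.* ∑ g            ≡⟨ ℤ.-1*i≡-i (∑ g) ⟩
    ℤ.- ∑ g                ∎)


  -- Translating x by z = θ / v, where t(θ) is nonzero, multiplies every term by χ(θ) = -1.
  ∑-χ* : ∀ {v} → ¬ v ≈ 0# → ∑ (λ x → χ (x * v)) ≡ 0ℤ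
  ∑-χ* {v} v≉0 = let θ , tθ≉0 = t-≉0
                     z , vz≈θ = divide v≉0 θ in
    ∑-anti-invariant (χ-cong ∘ *-congʳ) z λ x → begin
      χ ((x + z) * v)            ≡⟨ χ-cong (distribʳ v x z) ⟩
      χ (x * v + z * v)          ≡⟨ χ-+ (x * v) (z * v) ⟩
      χ (x * v) ℤ.* χ (z * v)    ≡⟨ ≡.cong (χ (x * v) ℤ.*_) (χ-cong (trans (*-comm z v) vz≈θ)) ⟩
      χ (x * v) ℤ.* χ θ          ≡⟨ ≡.cong (χ (x * v) ℤ.*_) (χ≡-1 tθ≉0) ⟩
      χ (x * v) ℤ.* -1ℤ          ≡⟨ ≡.trans (ℤ.*-comm (χ (x * v)) -1ℤ) (ℤ.-1*i≡-i _) ⟩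
      ℤ.- χ (x * v)              ∎

  module _ {f : Carrier → Carrier} (f-cong : f Preserves _≈_ ⟶ _≈_) where

    bijective⇒balanced : Bijective _≈_ _≈_ f → ∀ {u} → ¬ u ≈ 0# → ∑ (λ x → χ (u * f x)) ≡ 0ℤ
    bijective⇒balanced (f-inj , f-surj) {u} u≉0 = begin
      ∑ (λ x → χ (u * f x))    ≡⟨ ∑-reindex (χ-cong ∘ *-congˡ) f-inverse ⟩
      ∑ (λ x → χ (u * x))      ≡⟨ ∑ℤ.sum-cong-≗ {N} (λ i → χ-cong (*-comm u (elem i))) ⟩
      ∑ (λ x → χ (x * u))      ≡⟨ ∑-χ* u≉0 ⟩
      0ℤ                       ∎
      where
      f-inverse : Inverse setoid setoid
      f-inverse = Bijection⇒Inverse (record { to = f ; cong = f-cong ; bijective = f-inj , f-surj })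

    -- Summing χ(u (f x + v)) over x first leaves only u = 0, which contributes |F|; summing
    -- over u first gives 0 unless v is a value of f.
    balanced⇒bijective : (∀ {u} → ¬ u ≈ 0# → ∑ (λ x → χ (u * f x)) ≡ 0ℤ) → Bijective _≈_ _≈_ f
    balanced⇒bijective balanced = strictlySurjective⇒injective f-cong surj , λ y →
      let x , fx≈y = surj y in x , λ z≈x → trans (f-cong z≈x) fx≈y
      where
      ∑ᵤ∑ₓ : Carrier → ℤ
      ∑ᵤ∑ₓ v = ∑ (λ u → ∑ (λ x → χ (u * (f x + v))))

      inner : ∀ v u → ∑ (λ x → χ (u * (f x + v))) ≡ ∑ (λ x → χ (u * f x)) ℤ.* χ (u * v)
      inner v u = begin
        ∑ (λ x → χ (u * (f x + v)))
          ≡⟨ ∑ℤ.sum-cong-≗ {N} (λ i → ≡.trans (χ-cong (distribˡ u _ v)) (χ-+ _ _)) ⟩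
        ∑ (λ x → χ (u * f x) ℤ.* χ (u * v))    ≡⟨ ∑ℤ.*-distribʳ-sum (χ (u * v)) (λ i → χ (u * f (elem i))) ⟨
        ∑ (λ x → χ (u * f x)) ℤ.* χ (u * v)    ∎

      inner-nonzero : ∀ v {u} → ¬ u ≈ 0# → ∑ (λ x → χ (u * (f x + v))) ≡ 0ℤ
      inner-nonzero v {u} u≉0 = ≡.trans (inner v u) (≡.cong (ℤ._* χ (u * v)) (balanced u≉0))

      inner-zero : ∀ v {u} → u ≈ 0# → ∑ (λ x → χ (u * (f x + v))) ≡ ∑ (const 1ℤ)
      inner-zero v {u} u≈0 = ∑ℤ.sum-cong-≗ {N} λ i →
        χ≡1 (trans (t-cong (trans (*-congʳ u≈0) (zeroˡ _))) t0≈0)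

      ∑ᵤ∑ₓ>0 : ∀ v → 0ℤ ℤ.< ∑ᵤ∑ₓ v
      ∑ᵤ∑ₓ>0 v = ∑-positive inner≥0 (λ u≈w → ∑ℤ.sum-cong-≗ {N} λ i → χ-cong (*-congʳ u≈w)) 0#
        (≡.subst (0ℤ ℤ.<_) (≡.sym (inner-zero v refl)) |F|>0)
        where
        inner≥0 : ∀ u → 0ℤ ℤ.≤ ∑ (λ x → χ (u * (f x + v)))
        inner≥0 u with u ≟ 0#
        ... | yes u≈0 = ≡.subst (0ℤ ℤ.≤_) (≡.sym (inner-zero v u≈0)) (ℤ.<⇒≤ |F|>0)
        ... | no  u≉0 = ℤ.≤-reflexive (≡.sym (inner-nonzero v u≉0))

      ∑ᵤ∑ₓ≡0 : ∀ v → ¬ (∃ λ x → f x ≈ v) → ∑ᵤ∑ₓ v ≡ 0ℤ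
      ∑ᵤ∑ₓ≡0 v missed = begin
        ∑ᵤ∑ₓ v                                       ≡⟨ ∑ℤ.∑-comm (λ i j → χ (elem i * (f (elem j) + v))) ⟩
        ∑ (λ x → ∑ (λ u → χ (u * (f x + v))))
          ≡⟨ ∑ℤ.sum-cong-≗ {N} (λ j → ∑-χ* λ eq → missed (elem j , x+y≈0⇒x≈y eq)) ⟩
        ∑ (const 0ℤ)                                 ≡⟨ ∑ℤ.sum-replicate-zero N ⟩
        0ℤ                                           ∎

      surj : ∀ v → ∃ λ x → f x ≈ v
      surj v with search (λ x≈y → trans (f-cong (sym x≈y))) (λ x → f x ≟ v)
      ... | yes hit    = hit
      ... | no  missed = contradiction (∑ᵤ∑ₓ≡0 v missed) (ℤ.<⇒≢ (∑ᵤ∑ₓ>0 v) ∘ ≡.sym)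

  -- Character sums of quadratic forms over 𝔽₂.

  -- Q is a quadratic form over 𝔽₂ with polar form (x , w) ↦ t (x ρ(w)), so the kernel of ρ is its radical.
  module QuadraticForm
    {Q ρ : Carrier → Carrier} (Q-cong : Q Preserves _≈_ ⟶ _≈_) (ρ-cong : ρ Preserves _≈_ ⟶ _≈_)
    (ρ-0 : ρ 0# ≈ 0#) (Q-+ : ∀ x w → t (Q (x + w)) ≈ t (Q x + Q w + x * ρ w)) where

    NonzeroOnRadical : Set _
    NonzeroOnRadical = ∃ λ w → ρ w ≈ 0# × ¬ t (Q w) ≈ 0#

    nonzeroOnRadical? : Dec NonzeroOnRadical
    nonzeroOnRadical? = search
      (λ x≈y (ρx≈0 , tQx≉0) → trans (ρ-cong (sym x≈y)) ρx≈0 , λ tQy≈0 → tQx≉0 (trans (t-cong (Q-cong x≈y)) tQy≈0))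
      (λ w → ρ w ≟ 0# ×-dec ¬? (t (Q w) ≟ 0#))

    χQ-+ : ∀ x w → χ (Q (x + w)) ≡ χ (Q x) ℤ.* χ (Q w) ℤ.* χ (x * ρ w)
    χQ-+ x w = begin
      χ (Q (x + w))                            ≡⟨ χ-resp-t (Q-+ x w) ⟩
      χ (Q x + Q w + x * ρ w)                  ≡⟨ χ-+ _ _ ⟩
      χ (Q x + Q w) ℤ.* χ (x * ρ w)            ≡⟨ ≡.cong (ℤ._* χ (x * ρ w)) (χ-+ _ _) ⟩
      χ (Q x) ℤ.* χ (Q w) ℤ.* χ (x * ρ w)      ∎

    χ[x*0]≡1 : ∀ {w} → ρ w ≈ 0# → ∀ x → χ (x * ρ w) ≡ 1ℤ
    χ[x*0]≡1 ρw≈0 x = χ≡1 (trans (t-cong (trans (*-congˡ ρw≈0) (zeroʳ x))) t0≈0)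

    -- Under `t`, translation by a radical vector w changes Q by the constant Q(w), so it negates
    -- every term χ(Q x).
    nonzeroOnRadical⇒balanced : NonzeroOnRadical → ∑ (χ ∘ Q) ≡ 0ℤ
    nonzeroOnRadical⇒balanced (w , ρw≈0 , tQw≉0) = ∑-anti-invariant (χ-cong ∘ Q-cong) w λ x → begin
      χ (Q (x + w))                          ≡⟨ χQ-+ x w ⟩
      χ (Q x) ℤ.* χ (Q w) ℤ.* χ (x * ρ w)
        ≡⟨ ≡.cong₂ (λ i j → χ (Q x) ℤ.* i ℤ.* j) (χ≡-1 tQw≉0) (χ[x*0]≡1 ρw≈0 x) ⟩
      χ (Q x) ℤ.* -1ℤ ℤ.* 1ℤ                 ≡⟨ ℤ.*-identityʳ _ ⟩
      χ (Q x) ℤ.* -1ℤ                        ≡⟨ ℤ.*-comm (χ (Q x)) -1ℤ ⟩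
      -1ℤ ℤ.* χ (Q x)                        ≡⟨ ℤ.-1*i≡-i _ ⟩
      ℤ.- χ (Q x)                            ∎

    -- (∑ χ∘Q)² = |F| ∑ χ(Q w) over the radical, which is positive when Q vanishes there.
    balanced⇒nonzeroOnRadical : ∑ (χ ∘ Q) ≡ 0ℤ → NonzeroOnRadical
    balanced⇒nonzeroOnRadical S≡0 = decidable-stable nonzeroOnRadical? λ vanishes →
      contradiction (≡.trans (≡.sym S²) (≡.cong₂ ℤ._*_ S≡0 S≡0)) (ℤ.<⇒≢ (S²>0 vanishes) ∘ ≡.sym)
      where
      S = ∑ (χ ∘ Q)

      h : Carrier → ℤ
      h w = χ (Q w) ℤ.* ∑ (λ x → χ (x * ρ w))

      h-cong : h Preserves _≈_ ⟶ _≡_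
      h-cong w≈z = ≡.cong₂ ℤ._*_ (χ-cong (Q-cong w≈z)) (∑ℤ.sum-cong-≗ {N} λ i → χ-cong (*-congˡ (ρ-cong w≈z)))

      -- After the shift by x the factor χ(Q x) occurs squared and disappears, which leaves a term
      -- depending on x only through the polar form.
      term : ∀ x w → χ (Q x) ℤ.* χ (Q (w + x)) ≡ χ (Q w) ℤ.* χ (x * ρ w)
      term x w = begin
        χ (Q x) ℤ.* χ (Q (w + x))
          ≡⟨ ≡.cong (χ (Q x) ℤ.*_) (≡.trans (χ-cong (Q-cong (+-comm w x))) (χQ-+ x w)) ⟩
        χ (Q x) ℤ.* (χ (Q x) ℤ.* χ (Q w) ℤ.* χ (x * ρ w))
          ≡⟨ ≡.cong (χ (Q x) ℤ.*_) (ℤ.*-assoc (χ (Q x)) _ _) ⟩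
        χ (Q x) ℤ.* (χ (Q x) ℤ.* (χ (Q w) ℤ.* χ (x * ρ w)))  ≡⟨ ℤ.*-assoc (χ (Q x)) _ _ ⟨
        χ (Q x) ℤ.* χ (Q x) ℤ.* (χ (Q w) ℤ.* χ (x * ρ w))
          ≡⟨ ≡.cong (ℤ._* (χ (Q w) ℤ.* χ (x * ρ w))) (χ²≡1 (Q x)) ⟩
        1ℤ ℤ.* (χ (Q w) ℤ.* χ (x * ρ w))                     ≡⟨ ℤ.*-identityˡ _ ⟩
        χ (Q w) ℤ.* χ (x * ρ w)                              ∎

      S² : S ℤ.* S ≡ ∑ h
      S² = begin
        S ℤ.* S                                            ≡⟨ ∑ℤ.*-distribʳ-sum S (χ ∘ Q ∘ elem) ⟩
        ∑ (λ x → χ (Q x) ℤ.* S)                            ≡⟨ ∑ℤ.sum-cong-≗ {N} row ⟩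
        ∑ (λ x → ∑ (λ w → χ (Q w) ℤ.* χ (x * ρ w)))
          ≡⟨ ∑ℤ.∑-comm (λ i j → χ (Q (elem j)) ℤ.* χ (elem i * ρ (elem j))) ⟩
        ∑ (λ w → ∑ (λ x → χ (Q w) ℤ.* χ (x * ρ w)))
          ≡⟨ ∑ℤ.sum-cong-≗ {N} (λ j → ∑ℤ.*-distribˡ-sum (χ (Q (elem j))) (λ i → χ (elem i * ρ (elem j)))) ⟨
        ∑ h                                                ∎
        where
        row : ∀ i → χ (Q (elem i)) ℤ.* S ≡ ∑ (λ w → χ (Q w) ℤ.* χ (elem i * ρ w))
        row i = let x = elem i in begin
          χ (Q x) ℤ.* S
            ≡⟨ ≡.cong (χ (Q x) ℤ.*_) (∑-reindex (χ-cong ∘ Q-cong) (translation x)) ⟨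
          χ (Q x) ℤ.* ∑ (λ w → χ (Q (w + x)))
            ≡⟨ ∑ℤ.*-distribˡ-sum (χ (Q x)) (λ j → χ (Q (elem j + x))) ⟩
          ∑ (λ w → χ (Q x) ℤ.* χ (Q (w + x)))              ≡⟨ ∑ℤ.sum-cong-≗ {N} (λ j → term x (elem j)) ⟩
          ∑ (λ w → χ (Q w) ℤ.* χ (x * ρ w))                ∎

      S²>0 : ¬ NonzeroOnRadical → 0ℤ ℤ.< ∑ h
      S²>0 vanishes = ∑-positive h≥0 h-cong 0# (≡.subst (0ℤ ℤ.<_) (≡.sym (h-radical ρ-0)) |F|>0)
        where
        h-radical : ∀ {w} → ρ w ≈ 0# → h w ≡ ∑ (const 1ℤ)
        h-radical {w} ρw≈0 = ≡.trans
          (≡.cong₂ ℤ._*_ (χ≡1 (decidable-stable (t (Q w) ≟ 0#) λ tQw≉0 → vanishes (w , ρw≈0 , tQw≉0)))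
                         (∑ℤ.sum-cong-≗ {N} λ i → χ[x*0]≡1 ρw≈0 (elem i)))
          (ℤ.*-identityˡ _)
        h≥0 : ∀ w → 0ℤ ℤ.≤ h w
        h≥0 w with ρ w ≟ 0#
        ... | yes ρw≈0 = ≡.subst (0ℤ ℤ.≤_) (≡.sym (h-radical ρw≈0)) (ℤ.<⇒≤ |F|>0)
        ... | no  ρw≉0 = ℤ.≤-reflexive (≡.sym (≡.trans (≡.cong (χ (Q w) ℤ.*_) (∑-χ* ρw≉0)) (ℤ.*-zeroʳ (χ (Q w)))))

-- The subfield 𝔽_q as the fixed field of Frobenius.

module Extension
  {c ℓ₁ ℓ₂ d e₁ e₂ : Level} (m n : ℕ) .{{m≢0 : NonZero m}} .{{n≢0 : NonZero n}}
  (E : FiniteFieldExtension (2 ℕ.^ m) n c ℓ₁ ℓ₂ d e₁ e₂) where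

  open FiniteFieldExtension E
  open F hiding (zero)
  open QLinear E
  open FiniteFieldOfCharacteristic2 top (m ℕ.* n) (ℕ.^-*-assoc 2 m n) top-card
  open Solver using (solve; con; _:=_; _:+_; _:*_; _:^_)
  open CommutativeSemiringExp commutativeSemiring using (^-distrib-*)
  open SemiringSum semiring using (sum-cong-≋; *-distribˡ-sum; *-distribʳ-sum)
  open RingMorphisms.IsRingMonomorphism ι-isRingMonomorphism
    using (0#-homo; 1#-homo; *-homo) renaming (⟦⟧-cong to ι-cong; injective to ι-injective)
  open import Relation.Binary.Reasoning.Setoid setoid

  private
    q : ℕ
    q = 2 ℕ.^ m

  -- Membership in 𝔽_q expressed by a decidable equation instead of a preimage under `ι`;
  -- `inBase⇒fixed` and `fixed⇒inBase` show that the two agree.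
  Fixed : Carrier → Set _
  Fixed x = x ^ q ≈ x

  fixed-resp : Fixed Respects _≈_
  fixed-resp x≈y fixed = trans (^-congˡ q (sym x≈y)) (trans fixed x≈y)

  fixed-* : ∀ {x y} → Fixed x → Fixed y → Fixed (x * y)
  fixed-* {x} {y} x-fixed y-fixed = trans (^-distrib-* x y q) (*-cong x-fixed y-fixed)

  fixed-cancelˡ : ∀ {x y} → ¬ x ≈ 0# → Fixed x → Fixed (x * y) → Fixed y
  fixed-cancelˡ {x} {y} x≉0 x-fixed xy-fixed = *-cancelˡ x≉0 (begin
    x * y ^ q      ≈⟨ *-congʳ x-fixed ⟨
    x ^ q * y ^ q  ≈⟨ ^-distrib-* x y q ⟨
    (x * y) ^ q    ≈⟨ xy-fixed ⟩
    x * y          ∎)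

  -- The 2^j-th power map is injective and commutes with the q-th power map.
  fixed-root : ∀ j {x} → Fixed (x ^ (2 ℕ.^ j)) → Fixed x
  fixed-root j {x} fixed = ^2^-injective j (trans (^-comm x q (2 ℕ.^ j)) fixed)

  fixed-^q^ : ∀ i {x} → Fixed x → x ^ (q ℕ.^ i) ≈ x
  fixed-^q^ zero    {x} fixed = *-identityʳ x
  fixed-^q^ (suc i) {x} fixed = trans (sym (^-assocʳ x q (q ℕ.^ i)))
    (trans (^-congˡ (q ℕ.^ i) fixed) (fixed-^q^ i fixed))

  ι-^ : ∀ x j → ι (x K.^ j) ≈ ι x ^ j
  ι-^ x zero    = 1#-homo
  ι-^ x (suc j) = trans (*-homo x (x K.^ j)) (*-congˡ (ι-^ x j))

  ι-fixed : ∀ x → Fixed (ι x)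
  ι-fixed x = trans (sym (ι-^ x q)) (ι-cong (x^|F|≈x base base-card x))

  ι≈0 : ∀ {x} → ι x ≈ 0# → x K.≈ K.0#
  ι≈0 ιx≈0 = ι-injective (trans ιx≈0 (sym 0#-homo))

  inBase⇒fixed : ∀ {x} → InBase x → Fixed x
  inBase⇒fixed (k , ιk≈x) = fixed-resp ιk≈x (ι-fixed k)

  private
    module Base = Inverse base-card

    base-elem-injective : Injective _≡_ _≈_ (ι ∘ Base.to)
    base-elem-injective {i} {j} eq = ≡.trans (≡.sym (Base.strictlyInverseʳ i))
      (≡.trans (Base.from-cong (ι-injective eq)) (Base.strictlyInverseʳ j))

    1<q : 1 ℕ.< q
    1<q = ℕ.^-monoʳ-< 2 (s<s z<s) {0} {m} (ℕ.>-nonZero⁻¹ m)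

  -- The q elements of 𝔽_q are roots of X^q + X; a fixed x outside them would be one root too many
  -- for the degree q.
  fixed⇒inBase : ∀ {x} → Fixed x → InBase x
  fixed⇒inBase {x} x-fixed with Fin.any? (λ i → ι (Base.to i) ≟ x)
  ... | yes (i , ιi≈x) = Base.to i , ιi≈x
  ... | no  missed     = contradiction roots
    (poly-roots 1≉0 (poly-cong (+-identityʳ 1#) (λ _ → refl) (poly-+ (poly-^ q) (poly-< 1<q (poly-^ 1))))
      root root-injective)
    where
    root : Fin (suc q) → Carrier
    root zero    = x
    root (suc i) = ι (Base.to i)
    root-injective : Injective _≡_ _≈_ root
    root-injective {zero}  {zero}  _  = ≡.refl
    root-injective {zero}  {suc j} eq = contradiction (j , sym eq) missed
    root-injective {suc i} {zero}  eq = contradiction (i , eq) missed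
    root-injective {suc i} {suc j} eq = ≡.cong suc (base-elem-injective eq)
    roots : ∀ i → root i ^ q + root i ^ 1 ≈ 0#
    roots i = trans (+-cong (root-fixed i) (*-identityʳ (root i))) (x+x≈0 (root i))
      where
      root-fixed : ∀ i → Fixed (root i)
      root-fixed zero    = x-fixed
      root-fixed (suc i) = ι-fixed (Base.to i)

  -- Traces to 𝔽_q and 𝔽₂, and the trace form.

  Tr-cong : Tr Preserves _≈_ ⟶ _≈_
  Tr-cong = partialTrace-cong m n

  Tr-+ : Additive Tr
  Tr-+ = partialTrace-+ m n

  Tr-fixed : ∀ x → Fixed (Tr x)
  Tr-fixed x = partialTrace-fixed m n (x^|F|≈x top top-card x)

  Tr-^2^ : ∀ j x → Tr (x ^ (2 ℕ.^ j)) ≈ Tr x ^ (2 ℕ.^ j)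
  Tr-^2^ = partialTrace-^2^ m n

  Tr-*ˡ : ∀ {y} → Fixed y → ∀ x → Tr (y * x) ≈ y * Tr x
  Tr-*ˡ {y} y-fixed x = begin
    Tr (y * x)
      ≈⟨ sum-cong-≋ {n} (λ i → trans (^-distrib-* y x (q ℕ.^ toℕ i)) (*-congʳ (fixed-^q^ (toℕ i) y-fixed))) ⟩
    sum {n} (λ i → y * x ^ (q ℕ.^ toℕ i))       ≈⟨ *-distribˡ-sum {n} y (λ i → x ^ (q ℕ.^ toℕ i)) ⟨
    y * Tr x                                    ∎

  -- The absolute trace of F, factored through `Tr` so that 𝔽_q-linearity of `Tr` can be used
  -- beneath it.
  t : Carrier → Carrier
  t x = partialTrace 1 m (Tr x)

  t-resp-Tr : ∀ {x y} → Tr x ≈ Tr y → t x ≈ t y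
  t-resp-Tr = partialTrace-cong 1 m

  t-cong : t Preserves _≈_ ⟶ _≈_
  t-cong = t-resp-Tr ∘ Tr-cong

  t-+ : Additive t
  t-+ x y = trans (partialTrace-cong 1 m (Tr-+ x y)) (partialTrace-+ 1 m (Tr x) (Tr y))

  t-0 : ∀ {x} → Tr x ≈ 0# → t x ≈ 0#
  t-0 Tr-x≈0 = trans (partialTrace-cong 1 m Tr-x≈0)
    (additive-0 (partialTrace-cong 1 m) (partialTrace-+ 1 m))

  t²≈t : ∀ x → t x ^ 2 ≈ t x
  t²≈t x = partialTrace-fixed 1 m (Tr-fixed x)

  t-² : ∀ x → t (x ^ 2) ≈ t x
  t-² x = begin
    t (x ^ 2)                        ≈⟨ partialTrace-cong 1 m (Tr-^2^ 1 x) ⟩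
    partialTrace 1 m (Tr x ^ 2)      ≈⟨ partialTrace-^2^ 1 m 1 (Tr x) ⟩
    t x ^ 2                          ≈⟨ t²≈t x ⟩
    t x                              ∎

  t-^2^ : ∀ j x → t (x ^ (2 ℕ.^ j)) ≈ t x
  t-^2^ zero    x = t-cong (*-identityʳ x)
  t-^2^ (suc j) x = trans (t-cong (sym (^-assocʳ x 2 (2 ℕ.^ j)))) (trans (t-^2^ j (x ^ 2)) (t-² x))

  t-^q^ : ∀ i x → t (x ^ (q ℕ.^ i)) ≈ t x
  t-^q^ i x = trans (t-cong (^-congʳ x (ℕ.^-*-assoc 2 m i))) (t-^2^ (m ℕ.* i) x)

  t-bit : ∀ x → t x ≈ 0# ⊎ t x ≈ 1#
  t-bit x with t x ≟ 0#
  ... | yes tx≈0 = inj₁ tx≈0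
  ... | no  tx≉0 = inj₂ (*-cancelˡ tx≉0 (trans (sym (x^2≈x*x (t x))) (trans (t²≈t x) (sym (*-identityʳ (t x))))))

  -- An element z with Tr(z) nonzero is rescaled by some y in 𝔽_q so that Tr(y z) becomes an element
  -- of 𝔽_q of nonzero absolute trace.
  t-≉0 : ∃ λ θ → ¬ t θ ≈ 0#
  t-≉0 =
    let i , T≉0    = partialTrace-≉0 1 m (ι ∘ Base.to) base-elem-injective
        j , τ≉0    = partialTrace-≉0 m n elem elem-injective
        τ-fixed    = Tr-fixed (elem j)
        y , τy≈κ   = divide τ≉0 (ι (Base.to i))
        y-fixed    = fixed-cancelˡ τ≉0 τ-fixed (fixed-resp (sym τy≈κ) (ι-fixed (Base.to i)))
        Tr-yz≈κ    = trans (Tr-*ˡ y-fixed (elem j)) (trans (*-comm y _) τy≈κ)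
    in y * elem j , λ t≈0 → T≉0 (trans (partialTrace-cong 1 m (sym Tr-yz≈κ)) t≈0)

  -- For nonzero v the products v z exhaust F, including an element of nonzero trace.
  t-nondegenerate : ∀ {v} → (∀ z → t (v * z) ≈ 0#) → v ≈ 0#
  t-nondegenerate {v} tv≈0 = decidable-stable (v ≟ 0#) λ v≉0 →
    let θ , tθ≉0 = t-≉0
        z , vz≈θ = divide v≉0 θ
    in tθ≉0 (trans (t-cong (sym vz≈θ)) (tv≈0 z))

  -- Both arguments have the same trace Tr(x) Tr(y) to 𝔽_q, as `Tr` is 𝔽_q-linear.
  t-self-adjoint : ∀ x y → t (x * Tr y) ≈ t (Tr x * y)
  t-self-adjoint x y = t-resp-Tr (begin
    Tr (x * Tr y)    ≈⟨ Tr-cong (*-comm x (Tr y)) ⟩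
    Tr (Tr y * x)    ≈⟨ Tr-*ˡ (Tr-fixed y) x ⟩
    Tr y * Tr x      ≈⟨ *-comm (Tr y) (Tr x) ⟩
    Tr x * Tr y      ≈⟨ Tr-*ˡ (Tr-fixed x) y ⟨
    Tr (Tr x * y)    ∎)

  -- The maps induced by q-linear polynomials and their adjoints.

  ⟨⟩-cong : ∀ L → (L ⟨_⟩) Preserves _≈_ ⟶ _≈_
  ⟨⟩-cong L x≈y = sum-cong-≋ {terms} λ i → *-congˡ (^-congˡ (q ℕ.^ toℕ i) x≈y)
    where open QLinearPolynomial L

  -- This 𝔽_q-linearity turns L₁(x) Tr(x) into L₁(x Tr(x)), to which the adjoint of L₁ applies.
  ⟨⟩-*ʳ : ∀ L x {y} → Fixed y → L ⟨ x ⟩ * y ≈ L ⟨ x * y ⟩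
  ⟨⟩-*ʳ L x {y} y-fixed = begin
    L ⟨ x ⟩ * y
      ≈⟨ *-distribʳ-sum {terms} y (λ i → coeff i * x ^ (q ℕ.^ toℕ i)) ⟩
    sum {terms} (λ i → coeff i * x ^ (q ℕ.^ toℕ i) * y)
      ≈⟨ sum-cong-≋ {terms} (λ i → trans (*-assoc (coeff i) _ y)
        (*-congˡ (trans (*-congˡ (sym (fixed-^q^ (toℕ i) y-fixed))) (sym (^-distrib-* x y (q ℕ.^ toℕ i)))))) ⟩
    L ⟨ x * y ⟩                                                     ∎
    where open QLinearPolynomial L

  iterate-frobenius⁻¹-^q^ : ∀ v i → iterate frobenius⁻¹ v i ^ (q ℕ.^ i) ≈ v
  iterate-frobenius⁻¹-^q^ v zero    = *-identityʳ v
  iterate-frobenius⁻¹-^q^ v (suc i) = begin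
    g ^ (q ℕ.* q ℕ.^ i)    ≈⟨ ^-assocʳ g q (q ℕ.^ i) ⟨
    (g ^ q) ^ (q ℕ.^ i)    ≈⟨ ^-comm g q (q ℕ.^ i) ⟩
    (g ^ (q ℕ.^ i)) ^ q    ≈⟨ ^-congˡ q (iterate-frobenius⁻¹-^q^ (frobenius⁻¹ v) i) ⟩
    frobenius⁻¹ v ^ q      ≈⟨ Inverse.strictlyInverseˡ frobenius v ⟩
    v                      ∎
    where g = iterate frobenius⁻¹ (frobenius⁻¹ v) i

  -- With a the i-th coefficient, u a x^(q^i) is the q^i-th power of (a u)^(q^(-i)) x, and `t` is
  -- invariant under Frobenius.
  t-adjoint : ∀ L u x → t (u * L ⟨ x ⟩) ≈ t (L ′⟨ u ⟩ * x)
  t-adjoint L u x = begin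
    t (u * L ⟨ x ⟩)
      ≈⟨ t-cong (*-distribˡ-sum {terms} u (λ i → coeff i * x ^ (q ℕ.^ toℕ i))) ⟩
    t (sum {terms} (λ i → u * (coeff i * x ^ (q ℕ.^ toℕ i))))        ≈⟨ additive-sum t-cong t-+ {terms} _ ⟩
    sum {terms} (λ i → t (u * (coeff i * x ^ (q ℕ.^ toℕ i))))        ≈⟨ sum-cong-≋ {terms} term ⟩
    sum {terms} (λ i → t (a′ i * x))                                 ≈⟨ additive-sum t-cong t-+ {terms} _ ⟨
    t (sum {terms} (λ i → a′ i * x))                                 ≈⟨ t-cong (*-distribʳ-sum {terms} x a′) ⟨
    t (L ′⟨ u ⟩ * x)                                                 ∎
    where
    open QLinearPolynomial L
    a′ : Fin terms → Carrier
    a′ i = iterate frobenius⁻¹ (coeff i * u) (toℕ i)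
    term : ∀ i → t (u * (coeff i * x ^ (q ℕ.^ toℕ i))) ≈ t (a′ i * x)
    term i = begin
      t (u * (coeff i * x ^ (q ℕ.^ toℕ i)))
        ≈⟨ t-cong (solve 3 (λ u a y → u :* (a :* y) := (a :* u) :* y) refl u (coeff i) _) ⟩
      t ((coeff i * u) * x ^ (q ℕ.^ toℕ i))
        ≈⟨ t-cong (*-congʳ (iterate-frobenius⁻¹-^q^ (coeff i * u) (toℕ i))) ⟨
      t (a′ i ^ (q ℕ.^ toℕ i) * x ^ (q ℕ.^ toℕ i))        ≈⟨ t-cong (^-distrib-* (a′ i) x (q ℕ.^ toℕ i)) ⟨
      t ((a′ i * x) ^ (q ℕ.^ toℕ i))                      ≈⟨ t-^q^ (toℕ i) (a′ i * x) ⟩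
      t (a′ i * x)                                        ∎

  -- Passes from scalars in the base field to Frobenius-fixed elements of F, the form in which
  -- traces supply coefficients.
  independent⇒ : ∀ {a b} → LinearlyIndependent (1# ∷ a ∷ b ∷ []) → ∀ {x y z} → Fixed x → Fixed y → Fixed z →
                 x + (y * a + z * b) ≈ 0# → y ≈ 0# × z ≈ 0#
  independent⇒ {a} {b} indep x-fixed y-fixed z-fixed relation =
    let k₀ , k₀≈x = fixed⇒inBase x-fixed
        k₁ , k₁≈y = fixed⇒inBase y-fixed
        k₂ , k₂≈z = fixed⇒inBase z-fixed
        k≈0 = indep (k₀ ∷ k₁ ∷ k₂ ∷ [])
          (trans (+-cong (trans (*-identityʳ _) k₀≈x)
            (+-cong (*-congʳ k₁≈y) (trans (+-identityʳ _) (*-congʳ k₂≈z)))) relation)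
    in trans (sym k₁≈y) (trans (ι-cong (k≈0 (suc zero))) 0#-homo)
     , trans (sym k₂≈z) (trans (ι-cong (k≈0 (suc (suc zero)))) 0#-homo)

  -- Every Tr(z) x + Tr(x) z lies in ker Tr; move the traces across with t-self-adjoint.
  annihilates-ker-Tr : ∀ {v} → (∀ y → Tr y ≈ 0# → t (v * y) ≈ 0#) → ∀ z → v * Tr z ≈ Tr (v * z)
  annihilates-ker-Tr {v} tv≈0 z = x+y≈0⇒x≈y (t-nondegenerate λ x → begin
    t ((v * Tr z + Tr (v * z)) * x)            ≈⟨ t-cong (distribʳ x _ _) ⟩
    t (v * Tr z * x + Tr (v * z) * x)          ≈⟨ t-+ _ _ ⟩
    t (v * Tr z * x) + t (Tr (v * z) * x)      ≈⟨ +-congˡ (t-self-adjoint (v * z) x) ⟨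
    t (v * Tr z * x) + t (v * z * Tr x)        ≈⟨ t-+ _ _ ⟨
    t (v * Tr z * x + v * z * Tr x)
      ≈⟨ t-cong (solve 5 (λ v z x τz τx → v :* τz :* x :+ v :* z :* τx := v :* (τz :* x :+ τx :* z))
        refl v z x (Tr z) (Tr x)) ⟩
    t (v * (Tr z * x + Tr x * z))              ≈⟨ tv≈0 _ (begin
      Tr (Tr z * x + Tr x * z)                   ≈⟨ Tr-+ _ _ ⟩
      Tr (Tr z * x) + Tr (Tr x * z)              ≈⟨ +-cong (Tr-*ˡ (Tr-fixed z) x) (Tr-*ˡ (Tr-fixed x) z) ⟩
      Tr z * Tr x + Tr x * Tr z
        ≈⟨ solve 2 (λ x y → x :* y :+ y :* x := con false) refl (Tr z) (Tr x) ⟩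
      0#                                         ∎) ⟩
    0#                                         ∎)

  0^2^≈0 : ∀ l → 0# ^ (2 ℕ.^ l) ≈ 0#
  0^2^≈0 l = additive-0 (^-congˡ (2 ℕ.^ l)) (^2^-+ l)

  -- The quadratic form attached to u, with a = L₀′(u) and b = L₁′(u).

  module Criterion (a b : Carrier) (l : ℕ) where

    Q ρ : Carrier → Carrier
    Q x = a * x ^ (2 ℕ.^ l) + b * (x * Tr x)
    ρ w = b * Tr w + Tr (b * w)

    Q-cong : Q Preserves _≈_ ⟶ _≈_
    Q-cong x≈y = +-cong (*-congˡ (^-congˡ (2 ℕ.^ l) x≈y)) (*-congˡ (*-cong x≈y (Tr-cong x≈y)))

    ρ-cong : ρ Preserves _≈_ ⟶ _≈_
    ρ-cong x≈y = +-cong (*-congˡ (Tr-cong x≈y)) (Tr-cong (*-congˡ x≈y))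

    ρ-0 : ρ 0# ≈ 0#
    ρ-0 = begin
      b * Tr 0# + Tr (b * 0#)    ≈⟨ +-cong (*-congˡ Tr-0) (trans (Tr-cong (zeroʳ b)) Tr-0) ⟩
      b * 0# + 0#                ≈⟨ trans (+-identityʳ _) (zeroʳ b) ⟩
      0#                         ∎
      where
      Tr-0 : Tr 0# ≈ 0#
      Tr-0 = additive-0 Tr-cong Tr-+

    -- The cross terms are b x Tr(w) and b w Tr(x); self-adjointness of `Tr` turns the second into x
    -- Tr(b w), and together they form x ρ(w).
    Q-+ : ∀ x w → t (Q (x + w)) ≈ t (Q x + Q w + x * ρ w)
    Q-+ x w = begin
      t (Q (x + w))
        ≈⟨ t-cong (+-cong (*-congˡ (^2^-+ l x w)) (*-congˡ (*-congˡ (Tr-+ x w)))) ⟩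
      t (a * (X + W) + b * ((x + w) * (Tr x + Tr w)))      ≈⟨ t-cong (solve 8 (λ a b x w X W τx τw →
          a :* (X :+ W) :+ b :* ((x :+ w) :* (τx :+ τw)) :=
          ((a :* X :+ b :* (x :* τx)) :+ (a :* W :+ b :* (w :* τw)) :+ x :* (b :* τw)) :+ (b :* w) :* τx)
                                                                refl a b x w X W (Tr x) (Tr w)) ⟩
      t (R + (b * w) * Tr x)                               ≈⟨ t-+ R _ ⟩
      t R + t ((b * w) * Tr x)                             ≈⟨ +-congˡ (t-self-adjoint (b * w) x) ⟩
      t R + t (Tr (b * w) * x)                             ≈⟨ t-+ R _ ⟨
      t (R + Tr (b * w) * x)
        ≈⟨ t-cong (solve 4 (λ r x y z → (r :+ x :* y) :+ z :* x := r :+ x :* (y :+ z))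
          refl (Q x + Q w) x (b * Tr w) (Tr (b * w))) ⟩
      t (Q x + Q w + x * ρ w)                              ∎
      where
      X = x ^ (2 ℕ.^ l)
      W = w ^ (2 ℕ.^ l)
      R = Q x + Q w + x * (b * Tr w)

    open AdditiveCharacter top (m ℕ.* n) (ℕ.^-*-assoc 2 m n) top-card t t-cong t-+ t-bit t-≉0
    open QuadraticForm Q-cong ρ-cong ρ-0 Q-+ public

    b^2ˡ : Carrier
    b^2ˡ = b ^ (2 ℕ.^ l)

    Condition : Set _
    Condition = (InBase b × ¬ (a ^ 2 + b^2ˡ) ≈ 0#) ⊎ LinearlyIndependent (1# ∷ a ∷ b^2ˡ ∷ [])

    -- For b in 𝔽_q, b x Tr(x) has the same trace as b x². Since `t` is invariant under squaring, a
    -- x^(2^l) may be squared and b x² raised to the power 2^l, so that both become multiples of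
    -- x^(2^(l+1)).
    t-Q-fixed : Fixed b → ∀ x → t (Q x) ≈ t ((a ^ 2 + b^2ˡ) * (x ^ (2 ℕ.^ l)) ^ 2)
    t-Q-fixed b-fixed x = begin
      t (Q x)                            ≈⟨ t-+ _ _ ⟩
      t (a * X) + t (b * (x * Tr x))     ≈⟨ +-cong (sym (t-² (a * X))) (t-resp-Tr Tr-part) ⟩
      t ((a * X) ^ 2) + t (b * x ^ 2)    ≈⟨ +-congˡ (t-^2^ l (b * x ^ 2)) ⟨
      t ((a * X) ^ 2) + t ((b * x ^ 2) ^ (2 ℕ.^ l))
        ≈⟨ +-cong (t-cong (^-distrib-* a X 2)) (t-cong (trans (^-distrib-* b (x ^ 2) (2 ℕ.^ l))
          (*-congˡ (^-comm x 2 (2 ℕ.^ l))))) ⟩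
      t (a ^ 2 * X ^ 2) + t (b^2ˡ * X ^ 2) ≈⟨ t-+ _ _ ⟨
      t (a ^ 2 * X ^ 2 + b^2ˡ * X ^ 2)   ≈⟨ t-cong (distribʳ (X ^ 2) (a ^ 2) b^2ˡ) ⟨
      t ((a ^ 2 + b^2ˡ) * X ^ 2)         ∎
      where
      X = x ^ (2 ℕ.^ l)
      Tr-part : Tr (b * (x * Tr x)) ≈ Tr (b * x ^ 2)
      Tr-part = begin
        Tr (b * (x * Tr x))
          ≈⟨ Tr-cong (solve 3 (λ b x y → b :* (x :* y) := (b :* y) :* x) refl b x (Tr x)) ⟩
        Tr ((b * Tr x) * x)      ≈⟨ Tr-*ˡ (fixed-* b-fixed (Tr-fixed x)) x ⟩
        b * Tr x * Tr x          ≈⟨ *-assoc b (Tr x) (Tr x) ⟩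
        b * (Tr x * Tr x)        ≈⟨ *-congˡ (trans (Tr-^2^ 1 x) (x^2≈x*x (Tr x))) ⟨
        b * Tr (x ^ 2)           ≈⟨ Tr-*ˡ b-fixed (x ^ 2) ⟨
        Tr (b * x ^ 2)           ∎

    t-Q-Tr≈0 : ∀ {w} → Tr w ≈ 0# → t (Q w) ≈ t (a * w ^ (2 ℕ.^ l))
    t-Q-Tr≈0 {w} Tr-w≈0 = t-cong
      (trans (+-congˡ (trans (*-congˡ (trans (*-congˡ Tr-w≈0) (zeroʳ w))) (zeroʳ b))) (+-identityʳ _))

    module _ (b-unfixed : ¬ Fixed b) where

      -- On the radical b Tr(w) = Tr(b w) lies in 𝔽_q, so a nonzero Tr(w) would put b into 𝔽_q.
      radical⇒Tr≈0 : ∀ {w} → ρ w ≈ 0# → Tr w ≈ 0#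
      radical⇒Tr≈0 {w} ρw≈0 = decidable-stable (Tr w ≟ 0#) λ Tr-w≉0 →
        b-unfixed (fixed-cancelˡ Tr-w≉0 (Tr-fixed w)
          (fixed-resp (trans (sym (x+y≈0⇒x≈y ρw≈0)) (*-comm b (Tr w))) (Tr-fixed (b * w))))

      radical⇒Tr[bw]≈0 : ∀ {w} → ρ w ≈ 0# → Tr (b * w) ≈ 0#
      radical⇒Tr[bw]≈0 {w} ρw≈0 = trans (sym (x+y≈0⇒x≈y ρw≈0)) (trans (*-congˡ (radical⇒Tr≈0 ρw≈0)) (zeroʳ b))

      -- With W = w^(2^l), multiplying a relation by W and taking `Tr` kills the terms of 1 and
      -- b^(2^l), because Tr(w) = Tr(b w) = 0. What remains forces k₁ = 0.
      nonzeroOnRadical⇒independent : NonzeroOnRadical → LinearlyIndependent (1# ∷ a ∷ b^2ˡ ∷ [])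
      nonzeroOnRadical⇒independent (w , ρw≈0 , tQw≉0) k relation = λ
        { zero → ι≈0 k₀≈0 ; (suc zero) → ι≈0 k₁≈0 ; (suc (suc zero)) → ι≈0 k₂≈0 }
        where
        W = w ^ (2 ℕ.^ l)
        k₀ = ι (k zero)
        k₁ = ι (k (suc zero))
        k₂ = ι (k (suc (suc zero)))
        Tr-W≈0 : Tr W ≈ 0#
        Tr-W≈0 = trans (Tr-^2^ l w) (trans (^-congˡ (2 ℕ.^ l) (radical⇒Tr≈0 ρw≈0)) (0^2^≈0 l))
        Tr-b^2ˡW≈0 : Tr (b^2ˡ * W) ≈ 0#
        Tr-b^2ˡW≈0 = trans (Tr-cong (sym (^-distrib-* b w (2 ℕ.^ l))))
          (trans (Tr-^2^ l (b * w)) (trans (^-congˡ (2 ℕ.^ l) (radical⇒Tr[bw]≈0 ρw≈0)) (0^2^≈0 l)))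
        Tr-aW≉0 : ¬ Tr (a * W) ≈ 0#
        Tr-aW≉0 eq = tQw≉0 (trans (t-Q-Tr≈0 (radical⇒Tr≈0 ρw≈0)) (t-0 eq))
        k₁≈0 : k₁ ≈ 0#
        k₁≈0 = zero-product Tr-aW≉0 (begin
          Tr (a * W) * k₁
            ≈⟨ solve 3 (λ x y z → x :* y := z :* con false :+ (y :* x :+ (con false :+ con false)))
              refl (Tr (a * W)) k₁ k₀ ⟩
          k₀ * 0# + (k₁ * Tr (a * W) + (0# + 0#))
            ≈⟨ +-cong (*-congˡ Tr-W≈0) (+-congˡ (+-congʳ (trans (*-congˡ Tr-b^2ˡW≈0) (zeroʳ k₂)))) ⟨
          k₀ * Tr W + (k₁ * Tr (a * W) + (k₂ * Tr (b^2ˡ * W) + 0#))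
            ≈⟨ +-cong (Tr-*ˡ (ι-fixed _) W) (+-cong (Tr-*ˡ (ι-fixed _) _) (+-congʳ (Tr-*ˡ (ι-fixed _) _))) ⟨
          Tr (k₀ * W) + (Tr (k₁ * (a * W)) + (Tr (k₂ * (b^2ˡ * W)) + 0#))
            ≈⟨ trans (Tr-+ _ _) (+-congˡ (trans (Tr-+ _ _) (+-congˡ (sym (+-identityʳ _))))) ⟨
          Tr (k₀ * W + (k₁ * (a * W) + k₂ * (b^2ˡ * W)))        ≈⟨ Tr-cong (solve 6 (λ k₀ k₁ k₂ a b W →
              k₀ :* W :+ (k₁ :* (a :* W) :+ k₂ :* (b :* W)) :=
              (k₀ :* con true :+ (k₁ :* a :+ (k₂ :* b :+ con false))) :* W) refl k₀ k₁ k₂ a b^2ˡ W) ⟩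
          Tr ((k₀ * 1# + (k₁ * a + (k₂ * b^2ˡ + 0#))) * W)
            ≈⟨ Tr-cong (trans (*-congʳ relation) (zeroˡ W)) ⟩
          Tr 0#                                                 ≈⟨ additive-0 Tr-cong Tr-+ ⟩
          0#                                                    ∎)
        k₂b^2ˡ≈k₀ : k₂ * b^2ˡ ≈ k₀
        k₂b^2ˡ≈k₀ = x+y≈0⇒x≈y (begin
          k₂ * b^2ˡ + k₀
            ≈⟨ solve 4 (λ k₀ k₂ a b → k₂ :* b :+ k₀ :=
              k₀ :* con true :+ (con false :* a :+ (k₂ :* b :+ con false))) refl k₀ k₂ a b^2ˡ ⟩
          k₀ * 1# + (0# * a + (k₂ * b^2ˡ + 0#))     ≈⟨ +-congˡ (+-congʳ (*-congʳ k₁≈0)) ⟨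
          k₀ * 1# + (k₁ * a + (k₂ * b^2ˡ + 0#))     ≈⟨ relation ⟩
          0#                                        ∎)
        k₂≈0 : k₂ ≈ 0#
        -- A nonzero k₂ would place b^(2^l), and hence its root b, in 𝔽_q.
        k₂≈0 = decidable-stable (k₂ ≟ 0#) λ k₂≉0 → b-unfixed (fixed-root l
          (fixed-cancelˡ k₂≉0 (ι-fixed _) (fixed-resp (sym k₂b^2ˡ≈k₀) (ι-fixed _))))
        k₀≈0 : k₀ ≈ 0#
        k₀≈0 = trans (sym k₂b^2ˡ≈k₀) (trans (*-congʳ k₂≈0) (zeroˡ b^2ˡ))

    nonzeroOnRadical⇒condition : NonzeroOnRadical → Condition
    nonzeroOnRadical⇒condition nz@(w , ρw≈0 , tQw≉0) with b ^ q ≟ b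
    ... | yes b-fixed   = inj₁ (fixed⇒inBase b-fixed , λ e≈0 → tQw≉0 (trans (t-Q-fixed b-fixed w)
                            (trans (t-cong (trans (*-congʳ e≈0) (zeroˡ _))) (additive-0 t-cong t-+))))
    ... | no  b-unfixed = inj₂ (nonzeroOnRadical⇒independent b-unfixed nz)

    -- Duality of trace forms: from independence to a point of the radical.

    module _ (indep : LinearlyIndependent (1# ∷ a ∷ b^2ˡ ∷ [])) where

      -- Otherwise c · 1 + 0 · a + 1 · c = 0 with c = b^(2^l) would be a nontrivial relation over
      -- 𝔽_q.
      b^2ˡ-unfixed : ¬ Fixed b^2ˡ
      b^2ˡ-unfixed fixed = 1≉0 (proj₂ (independent⇒ indep {b^2ˡ} {0#} {1#} fixed fixed-0 fixed-1
        (solve 2 (λ a b → b :+ (con false :* a :+ con true :* b) := con false) refl a b^2ˡ)))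
        where
        fixed-0 : Fixed 0#
        fixed-0 = 0^2^≈0 m
        fixed-1 : Fixed 1#
        fixed-1 = fixed-resp 1#-homo (ι-fixed K.1#)

      nonzeroTrace : ∃ λ z → ¬ Tr z ≈ 0#
      nonzeroTrace = let θ , tθ≉0 = t-≉0 in θ , tθ≉0 ∘ t-0

      -- If Tr(b^(2^l) y) vanished on ker Tr, then b^(2^l) Tr(z) = Tr(b^(2^l) z) for a z with Tr(z)
      -- nonzero, which would put b^(2^l) into 𝔽_q.
      b^2ˡ-on-ker-Tr : ∃ λ z → Tr z ≈ 0# × ¬ Tr (b^2ˡ * z) ≈ 0#
      b^2ˡ-on-ker-Tr with search
        (λ x≈y (Tr-x≈0 , Tr-bx≉0) →
          trans (Tr-cong (sym x≈y)) Tr-x≈0 , λ eq → Tr-bx≉0 (trans (Tr-cong (*-congˡ x≈y)) eq))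
        (λ z → Tr z ≟ 0# ×-dec ¬? (Tr (b^2ˡ * z) ≟ 0#))
      ... | yes found = found
      ... | no  none  = contradiction
        (fixed-cancelˡ (proj₂ nonzeroTrace) (Tr-fixed _) (fixed-resp
          (trans (sym (annihilates-ker-Tr (λ y Tr-y≈0 → t-0 (decidable-stable (Tr (b^2ˡ * y) ≟ 0#) λ Tr-by≉0 →
            none (y , Tr-y≈0 , Tr-by≉0))) (proj₁ nonzeroTrace))) (*-comm b^2ˡ _))
          (Tr-fixed _)))
        b^2ˡ-unfixed

      -- Suppose t(a z) vanishes on the common kernel. Up to the factor β, y ↦ β y + Tr(b^(2^l) y)
      -- y₂ projects ker Tr onto that kernel. By duality v annihilates ker Tr, so v Tr(z) = Tr(v z)
      -- is a relation among 1, a, b^(2^l) whose coefficient Tr(z) β at a is nonzero.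
      a-on-common-kernel : ∃ λ z → (Tr z ≈ 0# × Tr (b^2ˡ * z) ≈ 0#) × ¬ t (a * z) ≈ 0#
      a-on-common-kernel with search
        (λ x≈y ((Tr-x≈0 , Tr-bx≈0) , tax≉0) →
          (trans (Tr-cong (sym x≈y)) Tr-x≈0 , trans (Tr-cong (*-congˡ (sym x≈y))) Tr-bx≈0) ,
          λ eq → tax≉0 (trans (t-cong (*-congˡ x≈y)) eq))
        (λ z → (Tr z ≟ 0# ×-dec Tr (b^2ˡ * z) ≟ 0#) ×-dec ¬? (t (a * z) ≟ 0#))
      ... | yes found = found
      ... | no  none  = contradiction
        (zero-product (proj₂ nonzeroTrace) (proj₁ (independent⇒ indep (Tr-fixed (v * z))
          (fixed-* (Tr-fixed z) (Tr-fixed (b^2ˡ * y₂)))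
          (fixed-* (Tr-fixed z) (Tr-fixed (a * y₂))) relation)))
        (proj₂ (proj₂ b^2ˡ-on-ker-Tr))
        where
        z = proj₁ nonzeroTrace
        y₂ = proj₁ b^2ˡ-on-ker-Tr
        Tr-y₂≈0 = proj₁ (proj₂ b^2ˡ-on-ker-Tr)
        β = Tr (b^2ˡ * y₂)
        -- The image of a under the adjoint of that projection, so that t(v y) = t(a p).
        v = a * β + Tr (a * y₂) * b^2ˡ
        tv≈0 : ∀ y → Tr y ≈ 0# → t (v * y) ≈ 0#
        tv≈0 y Tr-y≈0 = begin
          t (v * y)
            ≈⟨ t-cong (solve 5 (λ a β α b y → (a :* β :+ α :* b) :* y := a :* (β :* y) :+ α :* (b :* y))
              refl a β (Tr (a * y₂)) b^2ˡ y) ⟩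
          t (a * (β * y) + Tr (a * y₂) * (b^2ˡ * y))       ≈⟨ t-+ _ _ ⟩
          t (a * (β * y)) + t (Tr (a * y₂) * (b^2ˡ * y))   ≈⟨ +-congˡ (t-self-adjoint (a * y₂) (b^2ˡ * y)) ⟨
          t (a * (β * y)) + t (a * y₂ * Tr (b^2ˡ * y))     ≈⟨ t-+ _ _ ⟨
          t (a * (β * y) + a * y₂ * γ)
            ≈⟨ t-cong (solve 4 (λ a x y γ → a :* x :+ a :* y :* γ := a :* (x :+ γ :* y))
              refl a (β * y) y₂ γ) ⟩
          t (a * p)
            ≈⟨ decidable-stable (t (a * p) ≟ 0#) (λ tap≉0 → none (p , (Tr-p≈0 , Tr-bp≈0) , tap≉0)) ⟩
          0#                                               ∎
          where
          γ = Tr (b^2ˡ * y)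
          p = β * y + γ * y₂
          Tr-p≈0 : Tr p ≈ 0#
          Tr-p≈0 = begin
            Tr p                        ≈⟨ Tr-+ _ _ ⟩
            Tr (β * y) + Tr (γ * y₂)    ≈⟨ +-cong (Tr-*ˡ (Tr-fixed _) y) (Tr-*ˡ (Tr-fixed _) y₂) ⟩
            β * Tr y + γ * Tr y₂        ≈⟨ +-cong (*-congˡ Tr-y≈0) (*-congˡ Tr-y₂≈0) ⟩
            β * 0# + γ * 0#
              ≈⟨ solve 2 (λ β γ → β :* con false :+ γ :* con false := con false) refl β γ ⟩
            0#                          ∎
          Tr-bp≈0 : Tr (b^2ˡ * p) ≈ 0#
          Tr-bp≈0 = begin
            Tr (b^2ˡ * p)
              ≈⟨ Tr-cong (solve 5 (λ b β y γ z → b :* (β :* y :+ γ :* z) := β :* (b :* y) :+ γ :* (b :* z))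
                refl b^2ˡ β y γ y₂) ⟩
            Tr (β * (b^2ˡ * y) + γ * (b^2ˡ * y₂))        ≈⟨ Tr-+ _ _ ⟩
            Tr (β * (b^2ˡ * y)) + Tr (γ * (b^2ˡ * y₂))
              ≈⟨ +-cong (Tr-*ˡ (Tr-fixed _) _) (Tr-*ˡ (Tr-fixed _) _) ⟩
            β * γ + γ * β
              ≈⟨ solve 2 (λ β γ → β :* γ :+ γ :* β := con false) refl β γ ⟩
            0#                                           ∎
        relation : Tr (v * z) + (Tr z * β * a + Tr z * Tr (a * y₂) * b^2ˡ) ≈ 0#
        relation = begin
          Tr (v * z) + (Tr z * β * a + Tr z * Tr (a * y₂) * b^2ˡ)
            ≈⟨ +-cong (sym (annihilates-ker-Tr tv≈0 z))
              (solve 5 (λ τ β a α b → τ :* β :* a :+ τ :* α :* b := (a :* β :+ α :* b) :* τ)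
                refl (Tr z) β a (Tr (a * y₂)) b^2ˡ) ⟩
          v * Tr z + v * Tr z                                        ≈⟨ x+x≈0 _ ⟩
          0#                                                         ∎

      -- The point z is pulled back along the bijective 2^l-th power map, with which `Tr` commutes.
      independent⇒nonzeroOnRadical : NonzeroOnRadical
      independent⇒nonzeroOnRadical =
        let z , (Tr-z≈0 , Tr-bz≈0) , taz≉0 = a-on-common-kernel
            w , w^2ˡ≈z = ^2^-root l z
            Tr-w≈0  = x^j≈0⇒x≈0 (2 ℕ.^ l) (trans (sym (Tr-^2^ l w)) (trans (Tr-cong w^2ˡ≈z) Tr-z≈0))
            Tr-bw≈0 = x^j≈0⇒x≈0 (2 ℕ.^ l) (trans (sym (Tr-^2^ l (b * w)))
                        (trans (Tr-cong (trans (^-distrib-* b w (2 ℕ.^ l)) (*-congˡ w^2ˡ≈z))) Tr-bz≈0))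
        in w , trans (+-cong (trans (*-congˡ Tr-w≈0) (zeroʳ b)) Tr-bw≈0) (+-identityˡ 0#)
             , λ tQw≈0 → taz≉0 (trans (t-cong (*-congˡ (sym w^2ˡ≈z))) (trans (sym (t-Q-Tr≈0 Tr-w≈0)) tQw≈0))

    condition⇒nonzeroOnRadical : Condition → NonzeroOnRadical
    condition⇒nonzeroOnRadical (inj₂ indep)           = independent⇒nonzeroOnRadical indep
    condition⇒nonzeroOnRadical (inj₁ (b-inBase , e≉0)) =
      let b-fixed    = inBase⇒fixed b-inBase
          θ , tθ≉0   = t-≉0
          -- The witness w solves (a² + b^(2^l)) w^(2^(l+1)) = θ by one division and two root
          -- extractions.
          y , ey≈θ   = divide e≉0 θ
          x , x²≈y   = ^2^-root 1 y
          w , w^2ˡ≈x = ^2^-root l x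
      -- For b in 𝔽_q every w lies in the radical, as Tr(b w) = b Tr(w).
      in w , trans (+-congˡ (Tr-*ˡ b-fixed w)) (x+x≈0 _)
           , λ tQw≈0 → tθ≉0 (begin
               t θ                                          ≈⟨ t-cong ey≈θ ⟨
               t ((a ^ 2 + b^2ˡ) * y)
                 ≈⟨ t-cong (*-congˡ (trans (^-congˡ 2 w^2ˡ≈x) x²≈y)) ⟨
               t ((a ^ 2 + b^2ˡ) * (w ^ (2 ℕ.^ l)) ^ 2)     ≈⟨ t-Q-fixed b-fixed w ⟨
               t (Q w)                                      ≈⟨ tQw≈0 ⟩
               0#                                           ∎)

  -- The permutation criterion, reduced to one quadratic form for each nonzero u.

  module _ (l : ℕ) (L₀ L₁ : QLinearPolynomial) where

    private
      f : Carrier → Carrier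
      f x = L₀ ⟨ x ^ (2 ℕ.^ l) ⟩ + L₁ ⟨ x ⟩ * Tr x

      module C u = Criterion (L₀ ′⟨ u ⟩) (L₁ ′⟨ u ⟩) l

      f-cong : f Preserves _≈_ ⟶ _≈_
      f-cong x≈y = +-cong (⟨⟩-cong L₀ (^-congˡ (2 ℕ.^ l) x≈y)) (*-cong (⟨⟩-cong L₁ x≈y) (Tr-cong x≈y))

      t-uf : ∀ u x → t (u * f x) ≈ t (C.Q u x)
      t-uf u x = begin
        t (u * f x)                                            ≈⟨ t-cong (distribˡ u _ _) ⟩
        t (u * L₀ ⟨ x ^ (2 ℕ.^ l) ⟩ + u * (L₁ ⟨ x ⟩ * Tr x))   ≈⟨ t-+ _ _ ⟩
        t (u * L₀ ⟨ x ^ (2 ℕ.^ l) ⟩) + t (u * (L₁ ⟨ x ⟩ * Tr x))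
          ≈⟨ +-congˡ (t-cong (*-congˡ (⟨⟩-*ʳ L₁ x (Tr-fixed x)))) ⟩
        t (u * L₀ ⟨ x ^ (2 ℕ.^ l) ⟩) + t (u * L₁ ⟨ x * Tr x ⟩)
          ≈⟨ +-cong (t-adjoint L₀ u _) (t-adjoint L₁ u _) ⟩
        t (L₀ ′⟨ u ⟩ * x ^ (2 ℕ.^ l)) + t (L₁ ′⟨ u ⟩ * (x * Tr x)) ≈⟨ t-+ _ _ ⟨
        t (C.Q u x)                                            ∎

      open AdditiveCharacter top (m ℕ.* n) (ℕ.^-*-assoc 2 m n) top-card t t-cong t-+ t-bit t-≉0
      open SumOver ℤ.+-0-commutativeMonoid

      ∑-χf : ∀ u → ∑ (λ x → χ (u * f x)) ≡ ∑ (χ ∘ C.Q u)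
      ∑-χf u = ∑ℤ.sum-cong-≗ {(2 ℕ.^ m) ℕ.^ n} λ i → χ-resp-t (t-uf u (elem i))

    permutation⇔condition : IsPermutationPolynomial f ⇔ (∀ u → ¬ u ≈ 0# → C.Condition u)
    permutation⇔condition = mk⇔
      (λ bijective u u≉0 → C.nonzeroOnRadical⇒condition u (C.balanced⇒nonzeroOnRadical u
        (≡.trans (≡.sym (∑-χf u)) (bijective⇒balanced f-cong bijective u≉0))))
      (λ condition → balanced⇒bijective f-cong λ {u} u≉0 →
        ≡.trans (∑-χf u) (C.nonzeroOnRadical⇒balanced u (C.condition⇒nonzeroOnRadical u (condition u u≉0))))

theorem12 :
  ∀ {c ℓ₁ ℓ₂ d e₁ e₂ : Level} (m n l : ℕ) .{{_ : NonZero m}} .{{_ : NonZero n}}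
  (E : FiniteFieldExtension (2 ℕ.^ m) n c ℓ₁ ℓ₂ d e₁ e₂) →
  let open FiniteFieldExtension E
      open F
      open QLinear E
  in
  (L₀ L₁ : QLinearPolynomial) →
  IsPermutationPolynomial (λ x → L₀ ⟨ x ^ (2 ℕ.^ l) ⟩ + L₁ ⟨ x ⟩ * Tr x)
    ⇔
  (∀ (u : Carrier) → ¬ u ≈ 0# →
    (InBase (L₁ ′⟨ u ⟩) × ¬ (L₀ ′⟨ u ⟩ ^ 2 + L₁ ′⟨ u ⟩ ^ (2 ℕ.^ l)) ≈ 0#)
    ⊎ LinearlyIndependent (1# ∷ L₀ ′⟨ u ⟩ ∷ L₁ ′⟨ u ⟩ ^ (2 ℕ.^ l) ∷ []))
theorem12 m n l E L₀ L₁ = Extension.permutation⇔condition m n E l L₀ L₁
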